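{- Consider the following dispersion process on the two-way infinite path $L$ with vertex set $\mathbb{Z}$ and edges $\{i,i+1\}$, $i\in\mathbb{Z}$. Initially $n$ particles are placed at the vertex $0$ and all other vertices are empty. Time is discrete; at each time step, every particle located at a vertex currently holding at least $2$ particles moves to one of the two neighbours of that vertex ($i-1$ or $i+1$), each with probability $1/2$, independently of all other choices, while every particle that is alone at its vertex stays put. The process stops at the first time $T$ at which every vertex holds at most one particle. Then there is an absolute constant $K>0$ such that, with probability tending to $1$ as $n\to\infty$, the process stops (i.e. $T<\infty$) and at time $T$ every particle is at distance at most $Kn$ from the origin.
   Context: "With high probability" (w.h.p.) means with probability tending to $1$ as $n\to\infty$. The statement that the furthest particle from the origin is at distance $O(n)$ when the process stops w.h.p. is expressed by the existence of the constant $K$ above. -}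

module Defs where

open import Data.Bool using (Bool; true; false; if_then_else_; _∧_)
open import Data.Nat as ℕ using (ℕ; zero; suc)
open import Data.Integer as ℤ using (ℤ; +_)
open import Data.List using (List; []; _∷_; length; replicate)
open import Data.Rational using (ℚ; 0ℚ; 1ℚ; ½; _+_; _*_)
open import Relation.Nullary.Decidable using (⌊_⌋)

allB : {A : Set} → (A → Bool) → List A → Bool
allB p [] = true
allB p (x ∷ xs) = p x ∧ allB p xs

-- number of particles at vertex x in configuration c (list of particle positions)
occ : List ℤ → ℤ → ℕ
occ [] x = 0
occ (y ∷ ys) x = if ⌊ y ℤ.≟ x ⌋ then suc (occ ys x) else occ ys x

done : List ℤ → Bool
done c = allB (λ x → ⌊ occ c x ℕ.≤? 1 ⌋) c

within : ℕ → List ℤ → Bool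
within D c = allB (λ x → ⌊ ℤ.∣ x ∣ ℕ.≤? D ⌋) c

indicator : Bool → ℚ
indicator true = 1ℚ
indicator false = 0ℚ

-- Expectation of k(new configuration) over one step of the process:
-- 'orig' is the configuration at the start of the step (used for occupancy),
-- the second list is the particles not yet processed.  Each particle at a
-- vertex with ≥ 2 particles moves to x-1 or x+1 with probability 1/2
-- independently; lone particles stay.
stepAvg : List ℤ → List ℤ → (List ℤ → ℚ) → ℚ
stepAvg orig [] k = k []
stepAvg orig (x ∷ xs) k =
  if ⌊ 2 ℕ.≤? occ orig x ⌋
  then (½ * stepAvg orig xs (λ ys → k ((x ℤ.- + 1) ∷ ys)))
     + (½ * stepAvg orig xs (λ ys → k ((x ℤ.+ + 1) ∷ ys)))
  else stepAvg orig xs (λ ys → k (x ∷ ys))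

probStopWithin : ℕ → ℕ → List ℤ → ℚ
probStopWithin D t c with done c
... | true = indicator (within D c)
probStopWithin D zero c | false = 0ℚ
probStopWithin D (suc t) c | false = stepAvg c c (probStopWithin D t)

start : ℕ → List ℤ
start n = replicate n (+ 0)

{-# OPTIONS --safe #-}
-- Record at every site x the word W x of left/right instructions used there, last one first. These
-- words are prefixes of independent fair coin sequences, one per site. Look at the moment when site
-- D + 1 = Kn + 1 is reached for the first time. Scanning the sites D, D - 1, …, 1, conservation of
-- particles determines the number of right-instructions in W v from the number of left-instructions in
-- W (v + 1) and the number of particles beyond v, so that few lengths of W v are possible. Moreover a
-- site is vacated by at least two particles at once, and if v and v + 1 are both empty then the last
-- to be vacated did not send anything to the other: W v ends in LL or W (v + 1) ends in RR. In a
-- run of holes all sites but one are therefore of these kinds, each of which has expected number 1/2 of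
-- compatible prefixes, and all but at most n sites are holes. So the expected number of
-- compatible scans ("certificates") is at most 73ⁿ (3/4)ᴰ up to a constant factor. Its conditional
-- expectation given the instructions used so far is a supermartingale which is at least 1 on exit from
-- [-D, D] to the right; the exit to the left is its mirror image. Inside [-D, D] the process
-- stops, because the bounded energy Σ x² grows by at least 1 per step on average.
module Submission where

open import Defs
open import Data.Nat as ℕ using (ℕ)
open import Data.Product using (Σ; ∃; _×_)
open import Data.Rational using (ℚ; 0ℚ; 1ℚ; _-_; _<_; _≤_)

open import Data.Bool using (Bool; true; false; if_then_else_; not)
open import Data.Integer as ℤ using (ℤ; +_; -[1+_])
import Data.Integer.Properties as ℤP
import Data.Integer.Tactic.RingSolver as ℤR
open import Data.List using (List; []; _∷_; length; _++_; map)
import Data.List.Properties as ListP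
open import Data.List.Relation.Unary.All as All using (All; []; _∷_)
open import Data.Nat using (zero; suc; z≤n; s≤s)
import Data.Nat.Properties as ℕP
import Data.Nat.Tactic.RingSolver as ℕR
open import Data.Product using (_,_; proj₁; proj₂)
open import Data.Rational using (½; _+_; _*_; -_; _/_; 1/_; nonNegative; >-nonZero; toℚᵘ; mkℚ)
open import Data.Rational.Properties as ℚP using (≤-refl; ≤-trans; ≤-reflexive; +-mono-≤)
open import Data.Rational.Solver using (module +-*-Solver)
open import Data.Rational.Unnormalised as ℚᵘ using (mkℚᵘ; *≡*; *≤*)
import Data.Rational.Unnormalised.Properties as ℚᵘP
open import Data.Sum using (_⊎_; inj₁; inj₂)
open import Data.Unit using (⊤)
open import Relation.Binary.PropositionalEquality
  using (_≡_; _≢_; refl; sym; trans; cong; cong₂; subst; subst₂; module ≡-Reasoning)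
open import Relation.Nullary using (Dec; yes; no; contradiction)
open import Relation.Nullary.Decidable using (⌊_⌋; True; toWitness)
open +-*-Solver using (solve; _:+_; _:*_; _:-_; _:=_; con)

-- Rational inequalities and fair averages.

decided : ∀ {p q} {_ : True (p ℚP.≤? q)} → p ≤ q
decided {_} {_} {t} = toWitness t

*-monoˡ : ∀ {c a b} → 0ℚ ≤ c → a ≤ b → c * a ≤ c * b
*-monoˡ {c} 0≤c a≤b = ℚP.*-monoˡ-≤-nonNeg c {{nonNegative 0≤c}} a≤b

*-nonNeg : ∀ {a b} → 0ℚ ≤ a → 0ℚ ≤ b → 0ℚ ≤ a * b
*-nonNeg {a} 0≤a 0≤b = ≤-trans (≤-reflexive (sym (ℚP.*-zeroʳ a))) (*-monoˡ 0≤a 0≤b)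

+-nonNeg : ∀ {a b} → 0ℚ ≤ a → 0ℚ ≤ b → 0ℚ ≤ a + b
+-nonNeg {a} 0≤a 0≤b = ≤-trans (≤-reflexive (sym (ℚP.+-identityʳ 0ℚ))) (+-mono-≤ 0≤a 0≤b)

≤-+ʳ : ∀ a {b} → 0ℚ ≤ b → a ≤ a + b
≤-+ʳ a 0≤b = ≤-trans (≤-reflexive (sym (ℚP.+-identityʳ a))) (+-mono-≤ (≤-refl {a}) 0≤b)

≤-+ˡ : ∀ {a} b → 0ℚ ≤ a → b ≤ a + b
≤-+ˡ {a} b 0≤a = ≤-trans (≤-reflexive (sym (ℚP.+-identityˡ b))) (+-mono-≤ 0≤a (≤-refl {b}))

0≤½ : 0ℚ ≤ ½
0≤½ = decided

½-mono : ∀ {a b} → a ≤ b → ½ * a ≤ ½ * b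
½-mono = *-monoˡ 0≤½

avg : ℚ → ℚ → ℚ
avg a b = ½ * a + ½ * b

avg-mono : ∀ {a b a′ b′} → a ≤ a′ → b ≤ b′ → avg a b ≤ avg a′ b′
avg-mono a≤a′ b≤b′ = +-mono-≤ (½-mono a≤a′) (½-mono b≤b′)

avg-nonNeg : ∀ {a b} → 0ℚ ≤ a → 0ℚ ≤ b → 0ℚ ≤ avg a b
avg-nonNeg 0≤a 0≤b = +-nonNeg (*-nonNeg 0≤½ 0≤a) (*-nonNeg 0≤½ 0≤b)

avg-idem : ∀ a → avg a a ≡ a
avg-idem = solve 1 (λ a → con ½ :* a :+ con ½ :* a := a) refl

-- A record rather than a synonym, so that unification can recover a, b and c.
infix 4 _⊕_⊑_
record _⊕_⊑_ (a b c : ℚ) : Set where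
  constructor below
  field avg≤ : avg a b ≤ c
open _⊕_⊑_

≤⇒⊑ : ∀ {a c} → a ≤ c → a ⊕ a ⊑ c
≤⇒⊑ {a} a≤c = below (≤-trans (≤-reflexive (avg-idem a)) a≤c)

⊑⇒≤ : ∀ {a c} → a ⊕ a ⊑ c → a ≤ c
⊑⇒≤ {a} (below h) = ≤-trans (≤-reflexive (sym (avg-idem a))) h

⊑-≤ : ∀ {a b c c′} → a ⊕ b ⊑ c → c ≤ c′ → a ⊕ b ⊑ c′
⊑-≤ (below h) c≤c′ = below (≤-trans h c≤c′)

⊑-swap : ∀ {a b c} → a ⊕ b ⊑ c → b ⊕ a ⊑ c
⊑-swap {a} {b} (below h) = below (≤-trans (≤-reflexive (ℚP.+-comm (½ * b) (½ * a))) h)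

⊑-+ : ∀ {a b c a′ b′ c′} → a ⊕ b ⊑ c → a′ ⊕ b′ ⊑ c′ → (a + a′) ⊕ (b + b′) ⊑ (c + c′)
⊑-+ {a} {b} {c} {a′} {b′} (below h) (below h′) = below (≤-trans (≤-reflexive
  (solve 4 (λ a b a′ b′ → con ½ :* (a :+ a′) :+ con ½ :* (b :+ b′)
     := (con ½ :* a :+ con ½ :* b) :+ (con ½ :* a′ :+ con ½ :* b′)) refl a b a′ b′)) (+-mono-≤ h h′))

⊑-avg : ∀ {a b c a′ b′ c′} → a ⊕ b ⊑ c → a′ ⊕ b′ ⊑ c′ → avg a a′ ⊕ avg b b′ ⊑ avg c c′
⊑-avg {a} {b} {c} {a′} {b′} (below h) (below h′) = below (≤-trans (≤-reflexive
  (solve 4 (λ a b a′ b′ →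
       con ½ :* (con ½ :* a :+ con ½ :* a′) :+ con ½ :* (con ½ :* b :+ con ½ :* b′)
     := con ½ :* (con ½ :* a :+ con ½ :* b) :+ con ½ :* (con ½ :* a′ :+ con ½ :* b′))
    refl a b a′ b′)) (avg-mono h h′))

-- Words of instructions and expected sums over their extensions.

-- Instructions used at a site, the most recent first; true is a step to the right.
Word : Set
Word = List Bool

#R #L : Word → ℕ
#R [] = 0
#R (true ∷ w) = suc (#R w)
#R (false ∷ w) = #R w
#L [] = 0
#L (true ∷ w) = #L w
#L (false ∷ w) = suc (#L w)

endsRR endsLL : Word → Bool
endsRR (true ∷ true ∷ _) = true
endsRR _ = false
endsLL (false ∷ false ∷ _) = true
endsLL _ = false

-- The expectation of Σ F u over the prefixes u ⊇ w, with at most H further letters, of a random sequence.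
extensions : ℕ → (Word → ℚ) → Word → ℚ
extensions zero F w = F w
extensions (suc H) F w = F w + avg (extensions H F (false ∷ w)) (extensions H F (true ∷ w))

extensions-nonNeg : ∀ H {F} w → (∀ u → 0ℚ ≤ F u) → 0ℚ ≤ extensions H F w
extensions-nonNeg zero w F≥0 = F≥0 w
extensions-nonNeg (suc H) w F≥0 = +-nonNeg (F≥0 w)
  (avg-nonNeg (extensions-nonNeg H (false ∷ w) F≥0) (extensions-nonNeg H (true ∷ w) F≥0))

extensions-head : ∀ H {F} w → (∀ u → 0ℚ ≤ F u) → F w ≤ extensions H F w
extensions-head zero w F≥0 = ≤-refl
extensions-head (suc H) {F} w F≥0 = ≤-+ʳ (F w)
  (avg-nonNeg (extensions-nonNeg H (false ∷ w) F≥0) (extensions-nonNeg H (true ∷ w) F≥0))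

extensions-⊑ : ∀ H {F G K} w → (∀ u → F u ⊕ G u ⊑ K u) →
  extensions H F w ⊕ extensions H G w ⊑ extensions H K w
extensions-⊑ zero w h = h w
extensions-⊑ (suc H) w h =
  ⊑-+ (h w) (⊑-avg (extensions-⊑ H (false ∷ w) h) (extensions-⊑ H (true ∷ w) h))

extensions-mono : ∀ H {F K} w → (∀ u → F u ≤ K u) → extensions H F w ≤ extensions H K w
extensions-mono H w h = ⊑⇒≤ (extensions-⊑ H w (λ u → ≤⇒⊑ (h u)))

extensions-suc : ∀ H {F} w → (∀ u → 0ℚ ≤ F u) → extensions H F w ≤ extensions (suc H) F w
extensions-suc zero w F≥0 = extensions-head 1 w F≥0
extensions-suc (suc H) {F} w F≥0 = +-mono-≤ (≤-refl {F w})
  (avg-mono (extensions-suc H (false ∷ w) F≥0) (extensions-suc H (true ∷ w) F≥0))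

-- A supersolution of the recursion behind `extensions` dominates it, uniformly in the horizon `H`.
-- Bounds on expected numbers of prefixes thus reduce to one local inequality per word.
extensions-majorant : ∀ {F U : Word → ℚ} → (∀ u → 0ℚ ≤ U u) →
  (∀ u → F u + avg (U (false ∷ u)) (U (true ∷ u)) ≤ U u) → ∀ H w → extensions H F w ≤ U w
extensions-majorant {F} {U} U≥0 sup zero w = ≤-trans
  (≤-+ʳ (F w) (avg-nonNeg (U≥0 (false ∷ w)) (U≥0 (true ∷ w)))) (sup w)
extensions-majorant {F} {U} U≥0 sup (suc H) w = ≤-trans
  (+-mono-≤ (≤-refl {F w}) (avg-mono (extensions-majorant U≥0 sup H (false ∷ w))
                                     (extensions-majorant U≥0 sup H (true ∷ w)))) (sup w)

-- Finite sums and the scan of a single site.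

sumBelow : ℕ → (ℕ → ℚ) → ℚ
sumBelow zero g = 0ℚ
sumBelow (suc b) g = g b + sumBelow b g

sumBelow-nonNeg : ∀ b {g} → (∀ j → 0ℚ ≤ g j) → 0ℚ ≤ sumBelow b g
sumBelow-nonNeg zero h = ≤-refl
sumBelow-nonNeg (suc b) h = +-nonNeg (h b) (sumBelow-nonNeg b h)

sumBelow-⊑ : ∀ b {f g k} → (∀ j → f j ⊕ g j ⊑ k j) → sumBelow b f ⊕ sumBelow b g ⊑ sumBelow b k
sumBelow-⊑ zero h = ≤⇒⊑ ≤-refl
sumBelow-⊑ (suc b) h = ⊑-+ (h b) (sumBelow-⊑ b h)

sumBelow-mono : ∀ b {f k} → (∀ j → f j ≤ k j) → sumBelow b f ≤ sumBelow b k
sumBelow-mono b h = ⊑⇒≤ (sumBelow-⊑ b (λ j → ≤⇒⊑ (h j)))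

sumBelow-term : ∀ {b j} {g} → (∀ j → 0ℚ ≤ g j) → j ℕ.< b → g j ≤ sumBelow b g
sumBelow-term {suc b} {j} {g} g≥0 (s≤s j≤b) with ℕP.m≤n⇒m<n∨m≡n j≤b
... | inj₁ j<b = ≤-trans (sumBelow-term g≥0 j<b) (≤-+ˡ _ (g≥0 b))
... | inj₂ refl = ≤-+ʳ (g b) (sumBelow-nonNeg b g≥0)

-- Scanning right to left: forced means that the site to the right is a hole whose word does not end in RR.
-- In hole and site, b is the number of particles not yet accounted for, and g the count for the rest of
-- the scan; the summand g free j stands for b - j particles at the site.
data State : Set where
  free forced : State

hole : State → ℕ → Word → (State → ℕ → ℚ) → ℚ
hole free b w g = if endsRR w then g free b else g forced b
hole forced b w g = if endsLL w then g forced b else 0ℚ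

site : State → ℕ → Word → (State → ℕ → ℚ) → ℚ
site q b w g = hole q b w g + sumBelow b (g free)

hole-nonNeg : ∀ q b w {g} → (∀ q b → 0ℚ ≤ g q b) → 0ℚ ≤ hole q b w g
hole-nonNeg free b w h with endsRR w
... | true = h free b
... | false = h forced b
hole-nonNeg forced b w h with endsLL w
... | true = h forced b
... | false = ≤-refl

hole-⊑ : ∀ q b w {f g k} → (∀ q b → f q b ⊕ g q b ⊑ k q b) → hole q b w f ⊕ hole q b w g ⊑ hole q b w k
hole-⊑ free b w h with endsRR w
... | true = h free b
... | false = h forced b
hole-⊑ forced b w h with endsLL w
... | true = h forced b
... | false = ≤⇒⊑ ≤-refl

site-nonNeg : ∀ q b w {g} → (∀ q b → 0ℚ ≤ g q b) → 0ℚ ≤ site q b w g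
site-nonNeg q b w h = +-nonNeg (hole-nonNeg q b w h) (sumBelow-nonNeg b (h free))

site-⊑ : ∀ q b w {f g k} → (∀ q b → f q b ⊕ g q b ⊑ k q b) → site q b w f ⊕ site q b w g ⊑ site q b w k
site-⊑ q b w h = ⊑-+ (hole-⊑ q b w h) (sumBelow-⊑ b (h free))

when : Bool → ℚ → ℚ
when p a = if p then a else 0ℚ

when-nonNeg : ∀ p {a} → 0ℚ ≤ a → 0ℚ ≤ when p a
when-nonNeg true h = h
when-nonNeg false h = ≤-refl

when-⊑ : ∀ p {a b c} → a ⊕ b ⊑ c → when p a ⊕ when p b ⊑ when p c
when-⊑ true h = h
when-⊑ false h = ≤⇒⊑ ≤-refl

-- Certificates and their supermartingale property.

-- W₀ and W₁ extend W by the two outcomes of one coin, at no more than one of the sites 1, …, v.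
data Branch : ℕ → (W W₀ W₁ : ℕ → Word) → Set where
  end : ∀ {W W₀ W₁} → Branch 0 W W₀ W₁
  same : ∀ {v W W₀ W₁} → W₀ (suc v) ≡ W (suc v) → W₁ (suc v) ≡ W (suc v) →
    Branch v W W₀ W₁ → Branch (suc v) W W₀ W₁
  here : ∀ {v W W₀ W₁} → W₀ (suc v) ≡ false ∷ W (suc v) → W₁ (suc v) ≡ true ∷ W (suc v) →
    Branch v W W₀ W₀ → Branch v W W₁ W₁ → Branch (suc v) W W₀ W₁

module Certificates (n : ℕ) where

  -- The expected number of scans of the sites v, …, 1, over words extending those of W by at most H
  -- letters each, where ℓ left-steps were made from site v + 1 and n ∸ b particles are beyond v.
  certs : ℕ → ℕ → (ℕ → Word) → State → ℕ → ℕ → ℚ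
  certs zero H W q b ℓ = 1ℚ
  certs (suc v) H W q b ℓ = extensions H
    (λ w → when (#R w ℕ.≡ᵇ ℓ ℕ.+ (n ℕ.∸ b)) (site q b w (λ q′ b′ → certs v H W q′ b′ (#L w))))
    (W (suc v))

  certs-nonNeg : ∀ v H W q b ℓ → 0ℚ ≤ certs v H W q b ℓ
  certs-nonNeg zero H W q b ℓ = decided
  certs-nonNeg (suc v) H W q b ℓ = extensions-nonNeg H (W (suc v))
    (λ w → when-nonNeg (#R w ℕ.≡ᵇ ℓ ℕ.+ (n ℕ.∸ b))
      (site-nonNeg q b w (λ q′ b′ → certs-nonNeg v H W q′ b′ (#L w))))

  -- Revealing one coin costs one unit of the horizon, because unfolding `extensions (suc H)` once
  -- separates the unextended word from the average over the next letter.
  certs-⊑ : ∀ {v W W₀ W₁} H → Branch v W W₀ W₁ → ∀ q b ℓ →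
    certs v H W₀ q b ℓ ⊕ certs v H W₁ q b ℓ ⊑ certs v (suc H) W q b ℓ
  certs-⊑ H end q b ℓ = ≤⇒⊑ ≤-refl
  certs-⊑ {suc v} {W} {W₀} {W₁} H (same e₀ e₁ br) q b ℓ rewrite e₀ | e₁ =
    ⊑-≤ (extensions-⊑ H (W (suc v)) λ w → when-⊑ (#R w ℕ.≡ᵇ ℓ ℕ.+ (n ℕ.∸ b))
          (site-⊑ q b w (λ q′ b′ → certs-⊑ H br q′ b′ (#L w))))
        (extensions-suc H (W (suc v)) λ w → when-nonNeg (#R w ℕ.≡ᵇ ℓ ℕ.+ (n ℕ.∸ b))
          (site-nonNeg q b w (λ q′ b′ → certs-nonNeg v (suc H) W q′ b′ (#L w))))
  certs-⊑ {suc v} {W} {W₀} {W₁} H (here e₀ e₁ br₀ br₁) q b ℓ rewrite e₀ | e₁ =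
    below (≤-trans
      (avg-mono (extensions-mono H (false ∷ W (suc v)) (lower br₀))
                (extensions-mono H (true ∷ W (suc v)) (lower br₁)))
      -- Once the next letter is known, the prefix equal to `W (suc v)` is no longer counted; its
      -- nonnegative summand is dropped.
      (≤-+ˡ _ (when-nonNeg (#R (W (suc v)) ℕ.≡ᵇ ℓ ℕ.+ (n ℕ.∸ b)) (site-nonNeg q b (W (suc v))
        (λ q′ b′ → certs-nonNeg v (suc H) W q′ b′ (#L (W (suc v))))))))
    where
      lower : ∀ {V} → Branch v W V V → ∀ w →
        when (#R w ℕ.≡ᵇ ℓ ℕ.+ (n ℕ.∸ b)) (site q b w (λ q′ b′ → certs v H V q′ b′ (#L w)))
        ≤ when (#R w ℕ.≡ᵇ ℓ ℕ.+ (n ℕ.∸ b)) (site q b w (λ q′ b′ → certs v (suc H) W q′ b′ (#L w)))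
      lower br w = ⊑⇒≤ (when-⊑ (#R w ℕ.≡ᵇ ℓ ℕ.+ (n ℕ.∸ b))
        (site-⊑ q b w (λ q′ b′ → certs-⊑ H br q′ b′ (#L w))))

-- The expected number of certificates at the start.

infixr 8 _^_
_^_ : ℚ → ℕ → ℚ
x ^ zero = 1ℚ
x ^ suc n = x * x ^ n

^-nonNeg : ∀ {x} n → 0ℚ ≤ x → 0ℚ ≤ x ^ n
^-nonNeg zero 0≤x = decided
^-nonNeg (suc n) 0≤x = *-nonNeg 0≤x (^-nonNeg n 0≤x)

hits : ℕ → ℕ → ℚ
hits a r = indicator (a ℕ.≡ᵇ r)

-- Upper bounds, for a fair coin sequence extending w and a = #R w, on the expected number of prefixes
-- u no shorter than w with #R u = r and last letters as prescribed by the predicate e.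
record Majorant (e : Word → Bool) (top : ℚ) : Set where
  field
    bound : ℕ → ℕ → Word → ℚ
    bound-nonNeg : ∀ a r w → 0ℚ ≤ bound a r w
    bound-[] : ∀ r → bound 0 r [] ≤ top
    bound-super : ∀ a r w →
      hits a r * indicator (e w) + avg (bound a r (false ∷ w)) (bound (suc a) r (true ∷ w)) ≤ bound a r w

2ℚ : ℚ
2ℚ = + 2 / 1

-- A coin sequence shows exactly `r` letters R in 1 + G successive prefixes, where G, the number of
-- letters L before the next R, has mean 1.
anyMajorant : Majorant (λ _ → true) 2ℚ
anyMajorant = record { bound = λ a r _ → U a r ; bound-nonNeg = λ a r _ → nn a r
                     ; bound-[] = λ r → ≤-refl ; bound-super = λ a r _ → sup a r }
  where
    U : ℕ → ℕ → ℚ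
    U zero r = 2ℚ
    U (suc a) zero = 0ℚ
    U (suc a) (suc r) = U a r
    nn : ∀ a r → 0ℚ ≤ U a r
    nn zero r = decided
    nn (suc a) zero = decided
    nn (suc a) (suc r) = nn a r
    sup : ∀ a r → hits a r * 1ℚ + avg (U a r) (U (suc a) r) ≤ U a r
    sup zero zero = decided
    sup zero (suc r) = decided
    sup (suc a) zero = decided
    sup (suc a) (suc r) = sup a r

-- From the empty word, only the prefix that stops at the `r`-th R can qualify. It does if the
-- letter before is R too, which has probability ½ for `r` at least 2 and is impossible otherwise.
RRMajorant : Majorant endsRR ½
RRMajorant = record { bound = U ; bound-nonNeg = nn ; bound-[] = top ; bound-super = sup }
  where
    U : ℕ → ℕ → Word → ℚ
    U zero zero w = indicator (endsRR w)
    U zero (suc zero) [] = 0ℚ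
    U zero (suc zero) (d ∷ w) = when d ½
    U zero (suc (suc r)) w = ½
    U (suc a) zero w = 0ℚ
    U (suc a) (suc r) w = U a r w
    nn : ∀ a r w → 0ℚ ≤ U a r w
    nn zero zero w with endsRR w
    ... | true = decided
    ... | false = decided
    nn zero (suc zero) [] = decided
    nn zero (suc zero) (true ∷ w) = decided
    nn zero (suc zero) (false ∷ w) = decided
    nn zero (suc (suc r)) w = decided
    nn (suc a) zero w = decided
    nn (suc a) (suc r) w = nn a r w
    top : ∀ r → U 0 r [] ≤ ½
    top zero = decided
    top (suc zero) = decided
    top (suc (suc r)) = decided
    sup : ∀ a r w → hits a r * indicator (endsRR w) + avg (U a r (false ∷ w)) (U (suc a) r (true ∷ w)) ≤ U a r w
    sup zero zero w with endsRR w
    ... | true = decided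
    ... | false = decided
    sup zero (suc zero) [] = decided
    sup zero (suc zero) (false ∷ w) = decided
    sup zero (suc zero) (true ∷ []) = decided
    sup zero (suc zero) (true ∷ false ∷ w) = decided
    sup zero (suc zero) (true ∷ true ∷ w) = decided
    sup zero (suc (suc zero)) w with endsRR w
    ... | true = decided
    ... | false = decided
    sup zero (suc (suc (suc r))) w with endsRR w
    ... | true = decided
    ... | false = decided
    sup (suc a) zero w with endsRR w
    ... | true = decided
    ... | false = decided
    sup (suc a) (suc r) w = sup a r w

-- After the `r`-th R, the next k letters are all L with probability 2⁻ᵏ, and the ending requires k
-- ≥ 2; these probabilities sum to ½. Once `r` is reached, the bound depends on the run of L in
-- which `w` already ends.
LLMajorant : Majorant endsLL ½
LLMajorant = record { bound = U ; bound-nonNeg = nn ; bound-[] = top ; bound-super = sup }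
  where
    U : ℕ → ℕ → Word → ℚ
    U zero zero [] = ½
    U zero zero (true ∷ w) = ½
    U zero zero (false ∷ []) = 1ℚ
    U zero zero (false ∷ true ∷ w) = 1ℚ
    U zero zero (false ∷ false ∷ w) = 2ℚ
    U zero (suc r) w = ½
    U (suc a) zero w = 0ℚ
    U (suc a) (suc r) w = U a r w
    nn : ∀ a r w → 0ℚ ≤ U a r w
    nn zero zero [] = decided
    nn zero zero (true ∷ w) = decided
    nn zero zero (false ∷ []) = decided
    nn zero zero (false ∷ true ∷ w) = decided
    nn zero zero (false ∷ false ∷ w) = decided
    nn zero (suc r) w = decided
    nn (suc a) zero w = decided
    nn (suc a) (suc r) w = nn a r w
    top : ∀ r → U 0 r [] ≤ ½
    top zero = decided
    top (suc r) = decided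
    sup : ∀ a r w → hits a r * indicator (endsLL w) + avg (U a r (false ∷ w)) (U (suc a) r (true ∷ w)) ≤ U a r w
    sup zero zero [] = decided
    sup zero zero (true ∷ w) = decided
    sup zero zero (false ∷ []) = decided
    sup zero zero (false ∷ true ∷ w) = decided
    sup zero zero (false ∷ false ∷ w) = decided
    sup zero (suc zero) w with endsLL w
    ... | true = decided
    ... | false = decided
    sup zero (suc (suc r)) w with endsLL w
    ... | true = decided
    ... | false = decided
    sup (suc a) zero w with endsLL w
    ... | true = decided
    ... | false = decided
    sup (suc a) (suc r) w = sup a r w

open Majorant

-- Words with the prescribed ending are charged `c`, all words `d`; the same combination of the two
-- majorants is a supersolution.
extensions-≤ : ∀ {e t} (M : Majorant e t) H {F} r {c d} → 0ℚ ≤ c → 0ℚ ≤ d →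
  (∀ w → F w ≤ c * (hits (#R w) r * indicator (e w)) + d * (hits (#R w) r * 1ℚ)) →
  extensions H F [] ≤ c * t + d * 2ℚ
extensions-≤ {e} {t} M H {F} r {c} {d} 0≤c 0≤d F≤ = ≤-trans
  (extensions-majorant U-nonNeg U-super H [])
  (+-mono-≤ (*-monoˡ 0≤c (bound-[] M r)) (*-monoˡ 0≤d (bound-[] anyMajorant r)))
  where
    m = bound M
    k = bound anyMajorant
    U : Word → ℚ
    U w = c * m (#R w) r w + d * k (#R w) r w
    U-nonNeg : ∀ w → 0ℚ ≤ U w
    U-nonNeg w = +-nonNeg (*-nonNeg 0≤c (bound-nonNeg M (#R w) r w))
                          (*-nonNeg 0≤d (bound-nonNeg anyMajorant (#R w) r w))
    U-super : ∀ w → F w + avg (U (false ∷ w)) (U (true ∷ w)) ≤ U w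
    U-super w = ≤-trans (+-mono-≤ (F≤ w) (≤-refl {avg (U (false ∷ w)) (U (true ∷ w))})) (≤-trans (≤-reflexive
      (solve 8 (λ c d p q x y z t →
          (c :* p :+ d :* q) :+ (con ½ :* (c :* x :+ d :* y) :+ con ½ :* (c :* z :+ d :* t))
          := c :* (p :+ (con ½ :* x :+ con ½ :* z)) :+ d :* (q :+ (con ½ :* y :+ con ½ :* t)))
        refl c d (hits (#R w) r * indicator (e w)) (hits (#R w) r * 1ℚ)
        (m (#R w) r (false ∷ w)) (k (#R w) r (false ∷ w)) (m (suc (#R w)) r (true ∷ w)) (k (suc (#R w)) r (true ∷ w))))
      (+-mono-≤ (*-monoˡ 0≤c (bound-super M (#R w) r w)) (*-monoˡ 0≤d (bound-super anyMajorant (#R w) r w))))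

¾ Z 9ℚ ⅛ : ℚ
¾ = + 3 / 4
Z = + 73 / 1
9ℚ = + 9 / 1
⅛ = + 1 / 8

weight : ℕ → ℕ → ℚ
weight v b = ¾ ^ v * Z ^ b

weight-nonNeg : ∀ v b → 0ℚ ≤ weight v b
weight-nonNeg v b = *-nonNeg (^-nonNeg v decided) (^-nonNeg b decided)

-- The vector (9, 1) makes scanning one site shrink the bounds of both states by the same factor ¾;
-- the factor `Z` per particle keeps the share of occupied sites down to ⅛ of the weight.
coefficient : State → ℚ
coefficient free = 9ℚ
coefficient forced = 1ℚ

-- 9 Σ_{j<b} 73ʲ ≤ 9 · 73ᵇ / 72.
sumBelow-weight : ∀ v b → sumBelow b (λ j → 9ℚ * weight v j) ≤ ⅛ * weight v b
sumBelow-weight v zero = *-nonNeg {⅛} decided (weight-nonNeg v 0)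
sumBelow-weight v (suc b) = ≤-trans
  (+-mono-≤ (≤-refl {9ℚ * weight v b}) (sumBelow-weight v b)) (≤-reflexive
  (solve 2 (λ p z → con 9ℚ :* (p :* z) :+ con ⅛ :* (p :* z) := con ⅛ :* (p :* (con Z :* z))) refl (¾ ^ v) (Z ^ b)))

1≤Z^ : ∀ b → 1ℚ ≤ Z ^ b
1≤Z^ zero = ≤-refl
1≤Z^ (suc b) = ≤-trans {j = Z * 1ℚ} decided (*-monoˡ {Z} decided (1≤Z^ b))

when-≤ : ∀ p {a c d} e → a ≤ c * indicator e + d →
  when p a ≤ c * (indicator p * indicator e) + d * (indicator p * 1ℚ)
when-≤ true {a} {c} {d} e h = ≤-trans h (≤-reflexive
  (solve 3 (λ c d e → c :* e :+ d := c :* (con 1ℚ :* e) :+ d :* (con 1ℚ :* con 1ℚ)) refl c d (indicator e)))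
when-≤ false {a} {c} {d} e h = ≤-reflexive
  (solve 3 (λ c d e → con 0ℚ := c :* (con 0ℚ :* e) :+ d :* (con 0ℚ :* con 1ℚ)) refl c d (indicator e))

module _ (n : ℕ) where
  open Certificates n

  -- Induction along the scan, in units of `weight v b`. From `free`, holes ending in RR give 9 · ½,
  -- other holes at most 1 · 2 and occupied sites at most ⅛ · 2, in total 9 · ¾. From `forced`,
  -- holes ending in LL give ½ and occupied sites ⅛ · 2, in total ¾.
  certs-initial : ∀ v H q b ℓ → certs v H (λ _ → []) q b ℓ ≤ coefficient q * weight v b
  certs-initial zero H q b ℓ = ≤-trans (1≤Z^ b) (≤-trans
    (≤-reflexive (solve 1 (λ z → z := con 1ℚ :* (con 1ℚ :* z)) refl (Z ^ b)))
    (coef q))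
    where
      coef : ∀ q → 1ℚ * weight 0 b ≤ coefficient q * weight 0 b
      coef free = ℚP.*-monoʳ-≤-nonNeg (weight 0 b) {{nonNegative (weight-nonNeg 0 b)}} {1ℚ} {9ℚ} decided
      coef forced = ≤-refl
  certs-initial (suc v) H free b ℓ = ≤-trans
    (extensions-≤ RRMajorant H (ℓ ℕ.+ (n ℕ.∸ b)) {9ℚ * X} {X + ⅛ * X}
      (*-nonNeg {9ℚ} decided X≥0) (+-nonNeg X≥0 (*-nonNeg {⅛} decided X≥0))
      (λ w → when-≤ (#R w ℕ.≡ᵇ ℓ ℕ.+ (n ℕ.∸ b)) {c = 9ℚ * X} {X + ⅛ * X} (endsRR w) (F≤ w)))
    (≤-reflexive (solve 2 (λ p z →
        con 9ℚ :* (p :* z) :* con ½ :+ (p :* z :+ con ⅛ :* (p :* z)) :* con 2ℚ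
        := con 9ℚ :* (con ¾ :* p :* z)) refl (¾ ^ v) (Z ^ b)))
    where
      X = weight v b
      X≥0 = weight-nonNeg v b
      g : Word → State → ℕ → ℚ
      g w q′ b′ = certs v H (λ _ → []) q′ b′ (#L w)
      hole≤ : ∀ w → hole free b w (g w) ≤ 9ℚ * X * indicator (endsRR w) + X
      hole≤ w with endsRR w
      ... | true = ≤-trans (certs-initial v H free b (#L w)) (≤-trans (≤-+ʳ (9ℚ * X) X≥0)
              (≤-reflexive (cong (_+ X) (sym (ℚP.*-identityʳ (9ℚ * X))))))
      ... | false = ≤-trans (certs-initial v H forced b (#L w)) (≤-reflexive
              (solve 1 (λ x → con 1ℚ :* x := con 9ℚ :* x :* con 0ℚ :+ x) refl X))
      F≤ : ∀ w → site free b w (g w) ≤ 9ℚ * X * indicator (endsRR w) + (X + ⅛ * X)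
      F≤ w = ≤-trans (+-mono-≤ (hole≤ w) (≤-trans
        (sumBelow-mono b (λ j → certs-initial v H free j (#L w))) (sumBelow-weight v b)))
        (≤-reflexive (ℚP.+-assoc (9ℚ * X * indicator (endsRR w)) X (⅛ * X)))
  certs-initial (suc v) H forced b ℓ = ≤-trans
    (extensions-≤ LLMajorant H (ℓ ℕ.+ (n ℕ.∸ b)) {X} {⅛ * X}
      X≥0 (*-nonNeg {⅛} decided X≥0)
      (λ w → when-≤ (#R w ℕ.≡ᵇ ℓ ℕ.+ (n ℕ.∸ b)) {c = X} {⅛ * X} (endsLL w) (F≤ w)))
    (≤-reflexive (solve 2 (λ p z →
        (p :* z) :* con ½ :+ con ⅛ :* (p :* z) :* con 2ℚ
        := con 1ℚ :* (con ¾ :* p :* z)) refl (¾ ^ v) (Z ^ b)))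
    where
      X = weight v b
      X≥0 = weight-nonNeg v b
      g : Word → State → ℕ → ℚ
      g w q′ b′ = certs v H (λ _ → []) q′ b′ (#L w)
      hole≤ : ∀ w → hole forced b w (g w) ≤ X * indicator (endsLL w)
      hole≤ w with endsLL w
      ... | true = ≤-trans (certs-initial v H forced b (#L w)) (≤-reflexive (ℚP.*-comm 1ℚ X))
      ... | false = ≤-reflexive (sym (ℚP.*-zeroʳ X))
      F≤ : ∀ w → site forced b w (g w) ≤ X * indicator (endsLL w) + ⅛ * X
      F≤ w = +-mono-≤ (hole≤ w) (≤-trans
        (sumBelow-mono b (λ j → certs-initial v H free j (#L w))) (sumBelow-weight v b))

  -- The scan begins beside site `suc D`, freshly reached by `n ∸ j` particles: it is not a hole,
  -- whence `free`, and no left-step was made from it, whence `0`.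
  certsTotal : ℕ → ℕ → (ℕ → Word) → ℚ
  certsTotal D H W = sumBelow n (λ j → certs D H W free j 0)

  certsTotal-nonNeg : ∀ D H W → 0ℚ ≤ certsTotal D H W
  certsTotal-nonNeg D H W = sumBelow-nonNeg n (λ j → certs-nonNeg D H W free j 0)

  certsTotal-⊑ : ∀ {D W W₀ W₁} H → Branch D W W₀ W₁ →
    certsTotal D H W₀ ⊕ certsTotal D H W₁ ⊑ certsTotal D (suc H) W
  certsTotal-⊑ H br = sumBelow-⊑ n (λ j → certs-⊑ H br free j 0)

  certsTotal-initial : ∀ D H → certsTotal D H (λ _ → []) ≤ ⅛ * weight D n
  certsTotal-initial D H = ≤-trans
    (sumBelow-mono n (λ j → certs-initial D H free j 0)) (sumBelow-weight D n)

-- The actual history is itself a certificate.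

length≡#R+#L : ∀ w → length w ≡ #R w ℕ.+ #L w
length≡#R+#L [] = refl
length≡#R+#L (true ∷ w) = cong suc (length≡#R+#L w)
length≡#R+#L (false ∷ w) = trans (cong suc (length≡#R+#L w)) (sym (ℕP.+-suc (#R w) (#L w)))

total : (ℕ → ℕ) → ℕ → ℕ
total o zero = 0
total o (suc m) = o (suc m) ℕ.+ total o m

-- A history seen from the sites 1, 2, …: o i particles are at site i, where the instructions w i were used.
record HalfLine (o : ℕ → ℕ) (w : ℕ → Word) : Set where
  field
    balance : ∀ i → o (suc i) ℕ.+ length (w (suc i)) ≡ #R (w i) ℕ.+ #L (w (suc (suc i)))
    holes : ∀ i → o i ≡ 0 → o (suc i) ≡ 0 → 0 ℕ.< length (w i) → 0 ℕ.< length (w (suc i)) →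
      endsLL (w i) ≡ true ⊎ endsRR (w (suc i)) ≡ true

≡ᵇ-refl : ∀ {a b} → a ≡ b → (a ℕ.≡ᵇ b) ≡ true
≡ᵇ-refl {zero} refl = refl
≡ᵇ-refl {suc a} refl = ≡ᵇ-refl {a} refl

module _ (n : ℕ) {o : ℕ → ℕ} {w : ℕ → Word} (hl : HalfLine o w) where
  open Certificates n
  open HalfLine hl

  Blocked : State → ℕ → Set
  Blocked free v = ⊤
  Blocked forced v = o v ≡ 0 × endsRR (w v) ≡ false × 0 ℕ.< length (w v)

  -- Here `f` stands for the number of particles beyond site `suc v`. The net flow across an edge
  -- equals the number of particles beyond it, and `balance` carries this over to the next edge on
  -- the left.
  balance-below : ∀ v f → #R (w (suc v)) ≡ #L (w (suc (suc v))) ℕ.+ f →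
    #R (w v) ≡ #L (w (suc v)) ℕ.+ (f ℕ.+ o (suc v))
  balance-below v f e = ℕP.+-cancelʳ-≡ (#L (w (suc (suc v)))) _ _ (begin
    #R (w v) ℕ.+ #L (w (suc (suc v))) ≡⟨ balance v ⟨
    o (suc v) ℕ.+ length (w (suc v)) ≡⟨ cong (o (suc v) ℕ.+_) (length≡#R+#L (w (suc v))) ⟩
    o (suc v) ℕ.+ (#R (w (suc v)) ℕ.+ #L (w (suc v))) ≡⟨ cong (λ r → o (suc v) ℕ.+ (r ℕ.+ #L (w (suc v)))) e ⟩
    o (suc v) ℕ.+ (#L (w (suc (suc v))) ℕ.+ f ℕ.+ #L (w (suc v)))
      ≡⟨ rearrange (o (suc v)) (#L (w (suc (suc v)))) f (#L (w (suc v))) ⟩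
    #L (w (suc v)) ℕ.+ (f ℕ.+ o (suc v)) ℕ.+ #L (w (suc (suc v))) ∎)
    where
      open ≡-Reasoning
      rearrange : ∀ a b c d → a ℕ.+ (b ℕ.+ c ℕ.+ d) ≡ d ℕ.+ (c ℕ.+ a) ℕ.+ b
      rearrange = ℕR.solve-∀

  #R>0⇒length>0 : ∀ u {a f} → 0 ℕ.< f → #R u ≡ a ℕ.+ f → 0 ℕ.< length u
  #R>0⇒length>0 [] {a} 0<f e = subst (0 ℕ.<_) (sym e) (ℕP.<-≤-trans 0<f (ℕP.m≤n+m _ a))
  #R>0⇒length>0 (_ ∷ u) 0<f e = s≤s z≤n

  -- The words used so far, not extended at all, form one of the scans counted. As `f` is positive,
  -- every site scanned has used a right-instruction, so its word is nonempty and `holes` applies.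
  1≤certs : ∀ v H q f → 0 ℕ.< f → f ℕ.+ total o v ℕ.≤ n → #R (w v) ≡ #L (w (suc v)) ℕ.+ f →
    Blocked q (suc v) → 1ℚ ≤ certs v H w q (n ℕ.∸ f) (#L (w (suc v)))
  1≤certs zero H q f 0<f f≤n bal bl = ≤-refl
  1≤certs (suc v) H q f 0<f f≤n bal bl = ≤-trans 1≤site
    (≤-trans (≤-reflexive (sym (cong (λ p → when p (site q b u g)) (≡ᵇ-refl hit))))
      (extensions-head H u (λ u → when-nonNeg (#R u ℕ.≡ᵇ ℓ ℕ.+ (n ℕ.∸ b))
        (site-nonNeg q b u (λ q′ b′ → certs-nonNeg v H w q′ b′ (#L u))))))
    where
      b = n ℕ.∸ f
      u = w (suc v)
      ℓ = #L (w (suc (suc v)))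
      g : State → ℕ → ℚ
      g q′ b′ = certs v H w q′ b′ (#L u)
      g-nonNeg : ∀ q′ b′ → 0ℚ ≤ g q′ b′
      g-nonNeg q′ b′ = certs-nonNeg v H w q′ b′ (#L u)
      hit : #R u ≡ ℓ ℕ.+ (n ℕ.∸ b)
      hit = trans bal (cong (ℓ ℕ.+_) (sym (ℕP.m∸[m∸n]≡n (ℕP.m+n≤o⇒m≤o f f≤n))))
      bal′ : #R (w v) ≡ #L u ℕ.+ (f ℕ.+ o (suc v))
      bal′ = balance-below v f bal
      f′≤n : f ℕ.+ o (suc v) ℕ.+ total o v ℕ.≤ n
      f′≤n = subst (ℕ._≤ n) (sym (ℕP.+-assoc f (o (suc v)) (total o v))) f≤n
      visited : 0 ℕ.< length u
      visited = #R>0⇒length>0 u 0<f bal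
      next : ∀ q′ → Blocked q′ (suc v) → 1ℚ ≤ g q′ (n ℕ.∸ (f ℕ.+ o (suc v)))
      next q′ = 1≤certs v H q′ (f ℕ.+ o (suc v)) (ℕP.<-≤-trans 0<f (ℕP.m≤m+n f _)) f′≤n bal′
      empty : o (suc v) ≡ 0 → ∀ q′ → Blocked q′ (suc v) → 1ℚ ≤ g q′ b
      empty o≡0 q′ bl = subst (λ x → 1ℚ ≤ g q′ (n ℕ.∸ x)) (trans (cong (f ℕ.+_) o≡0) (ℕP.+-identityʳ f)) (next q′ bl)
      1≤hole : ∀ q → Blocked q (suc (suc v)) → o (suc v) ≡ 0 → 1ℚ ≤ hole q b u g
      1≤hole free bl o≡0 with endsRR u in eq
      ... | true = empty o≡0 free _
      ... | false = empty o≡0 forced (o≡0 , eq , visited)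
      -- The hole to the right does not end in RR, so `holes` leaves only LL; a word ending in LL
      -- does not end in RR, which keeps the state `forced`.
      1≤hole forced (o′≡0 , ¬RR , visited′) o≡0 with holes (suc v) o≡0 o′≡0 visited visited′
      ... | inj₂ RR with () ← trans (sym RR) ¬RR
      ... | inj₁ LL rewrite LL = empty o≡0 forced (o≡0 , LL⇒¬RR u LL , visited)
        where
          LL⇒¬RR : ∀ u → endsLL u ≡ true → endsRR u ≡ false
          LL⇒¬RR (false ∷ _) _ = refl
      1≤site : 1ℚ ≤ site q b u g
      1≤site with o (suc v) in eq | next free _
      ... | zero | _ = ≤-trans (1≤hole q bl eq) (≤-+ʳ _ (sumBelow-nonNeg b (g-nonNeg free)))
      -- The summand chosen is `n ∸ (f ℕ.+ suc k)`, which is below `b` because the site is occupied.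
      ... | suc k | nx = ≤-trans nx (≤-trans
        (sumBelow-term (g-nonNeg free) (ℕP.∸-monoʳ-< (ℕP.m<m+n f (s≤s z≤n))
          (ℕP.m+n≤o⇒m≤o (f ℕ.+ suc k) (subst (λ x → f ℕ.+ x ℕ.+ total o v ℕ.≤ n) eq f′≤n))))
        (≤-+ˡ _ (hole-nonNeg q b u g-nonNeg)))

  -- The right end of the range: site suc D has just been reached and was never left.
  1≤certsTotal : ∀ D H → 0 ℕ.< o (suc D) → total o (suc D) ℕ.≤ n → w (suc D) ≡ [] → w (suc (suc D)) ≡ [] →
    1ℚ ≤ certsTotal n D H w
  1≤certsTotal D H 0<o tot e e′ = ≤-trans
    (subst (λ u → 1ℚ ≤ certs D H w free (n ℕ.∸ o (suc D)) (#L u)) e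
      (1≤certs D H free (o (suc D)) 0<o tot bal _))
    (sumBelow-term (λ j → certs-nonNeg D H w free j 0)
      (ℕP.∸-monoʳ-< {o = 0} 0<o (ℕP.m+n≤o⇒m≤o _ tot)))
    where
      bal : #R (w D) ≡ #L (w (suc D)) ℕ.+ o (suc D)
      bal = trans (balance-below D 0 (trans (cong #R e) (sym (trans (ℕP.+-identityʳ _) (cong #L e′))))) refl

-- One step of the process and the words it writes.

isYes⇒ : ∀ {P : Set} (d : Dec P) → ⌊ d ⌋ ≡ true → P
isYes⇒ (yes p) _ = p

indℤ : ℤ → ℤ → ℕ
indℤ y x = if ⌊ y ℤ.≟ x ⌋ then 1 else 0

indℤ-refl : ∀ x → indℤ x x ≡ 1
indℤ-refl x with x ℤ.≟ x
... | yes _ = refl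
... | no x≢x = contradiction refl x≢x

indℤ-≢ : ∀ {y x} → y ≢ x → indℤ y x ≡ 0
indℤ-≢ {y} {x} y≢x with y ℤ.≟ x
... | yes y≡x = contradiction y≡x y≢x
... | no _ = refl

indℤ-injective : ∀ {f : ℤ → ℤ} → (∀ {x y} → f x ≡ f y → x ≡ y) → ∀ y x → indℤ (f y) (f x) ≡ indℤ y x
indℤ-injective {f} inj y x with y ℤ.≟ x
... | yes refl = indℤ-refl (f x)
... | no y≢x = indℤ-≢ (λ e → y≢x (inj e))

occ-∷ : ∀ y ys x → occ (y ∷ ys) x ≡ indℤ y x ℕ.+ occ ys x
occ-∷ y ys x with y ℤ.≟ x
... | yes _ = refl
... | no _ = refl

x-1+1 : ∀ x → x ℤ.- + 1 ℤ.+ + 1 ≡ x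
x-1+1 = ℤR.solve-∀

x+1-1 : ∀ x → x ℤ.+ + 1 ℤ.- + 1 ≡ x
x+1-1 = ℤR.solve-∀

shift : Bool → ℤ → ℤ
shift false x = x ℤ.- + 1
shift true x = x ℤ.+ + 1

push : (ℤ → Word) → ℤ → Bool → ℤ → Word
push W p d x = if ⌊ p ℤ.≟ x ⌋ then d ∷ W x else W x

indR indL : Bool → ℤ → ℤ → ℕ
indR true p x = indℤ p x
indR false p x = 0
indL true p x = 0
indL false p x = indℤ p x

#R-push : ∀ W p d x → #R (push W p d x) ≡ indR d p x ℕ.+ #R (W x)
#R-push W p true x with p ℤ.≟ x
... | yes _ = refl
... | no _ = refl
#R-push W p false x with p ℤ.≟ x
... | yes _ = refl
... | no _ = refl

#L-push : ∀ W p d x → #L (push W p d x) ≡ indL d p x ℕ.+ #L (W x)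
#L-push W p true x with p ℤ.≟ x
... | yes _ = refl
... | no _ = refl
#L-push W p false x with p ℤ.≟ x
... | yes _ = refl
... | no _ = refl

length-push : ∀ W p d x → length (push W p d x) ≡ indℤ p x ℕ.+ length (W x)
length-push W p d x with p ℤ.≟ x
... | yes _ = refl
... | no _ = refl

ind-shift : ∀ d p x → indR d p (x ℤ.- + 1) ℕ.+ indL d p (x ℤ.+ + 1) ≡ indℤ (shift d p) x
ind-shift false p x = trans (sym (indℤ-injective {ℤ._- + 1} (λ {x} {y} e → trans (sym (x-1+1 x)) (trans (cong (ℤ._+ + 1) e) (x-1+1 y))) p (x ℤ.+ + 1)))
  (cong (indℤ (p ℤ.- + 1)) (x+1-1 x))
ind-shift true p x = trans (ℕP.+-identityʳ _) (trans (sym (indℤ-injective {ℤ._+ + 1} (λ {x} {y} e → trans (sym (x+1-1 x)) (trans (cong (ℤ._- + 1) e) (x+1-1 y))) p (x ℤ.- + 1)))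
  (cong (indℤ (p ℤ.+ + 1)) (x-1+1 x)))

crowded : List ℤ → ℤ → Bool
crowded o x = ⌊ 2 ℕ.≤? occ o x ⌋

-- Step o xs W ys W′: processing the particles xs of the configuration o can take them to ys,
-- the instructions used being recorded by turning W into W′.
data Step (o : List ℤ) : (xs : List ℤ) (W : ℤ → Word) (ys : List ℤ) (W′ : ℤ → Word) → Set where
  [] : ∀ {W} → Step o [] W [] W
  stay : ∀ {x xs W ys W′} → crowded o x ≡ false → Step o xs W ys W′ → Step o (x ∷ xs) W (x ∷ ys) W′
  move : ∀ {x xs W ys W′} d → crowded o x ≡ true → Step o xs (push W x d) ys W′ →
    Step o (x ∷ xs) W (shift d x ∷ ys) W′

Step-length : ∀ {o xs W ys W′} → Step o xs W ys W′ → length ys ≡ length xs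
Step-length [] = refl
Step-length (stay _ s) = cong suc (Step-length s)
Step-length (move _ _ s) = cong suc (Step-length s)

∣shift∣≤ : ∀ d x → ℤ.∣ shift d x ∣ ℕ.≤ suc ℤ.∣ x ∣
∣shift∣≤ false x = ℕP.≤-trans (ℤP.∣i-j∣≤∣i∣+∣j∣ x (+ 1)) (ℕP.≤-reflexive (ℕP.+-comm _ 1))
∣shift∣≤ true x = ℕP.≤-trans (ℤP.∣i+j∣≤∣i∣+∣j∣ x (+ 1)) (ℕP.≤-reflexive (ℕP.+-comm _ 1))

Step-range : ∀ {o xs W ys W′ D} → Step o xs W ys W′ → All (λ x → ℤ.∣ x ∣ ℕ.≤ D) xs → All (λ y → ℤ.∣ y ∣ ℕ.≤ suc D) ys
Step-range [] [] = []
Step-range (stay _ s) (x≤D ∷ xs≤D) = ℕP.m≤n⇒m≤1+n x≤D ∷ Step-range s xs≤D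
Step-range (move {x = x} d _ s) (x≤D ∷ xs≤D) = ℕP.≤-trans (∣shift∣≤ d x) (s≤s x≤D) ∷ Step-range s xs≤D

departures : List ℤ → List ℤ → ℤ → ℕ
departures o xs x = if crowded o x then occ xs x else 0

-- The block consists of the simultaneous departures. In a full step, where `xs` is `o`, a nonempty
-- block therefore has at least two letters.
Step-words : ∀ {o xs W ys W′} → Step o xs W ys W′ → ∀ x →
  ∃ λ block → W′ x ≡ block ++ W x × length block ≡ departures o xs x
Step-words {o} [] x with crowded o x
... | true = [] , refl , refl
... | false = [] , refl , refl
Step-words {o} {p ∷ xs} (stay lone s) x with p ℤ.≟ x | Step-words s x
... | no _ | r = r
... | yes refl | block , e , l rewrite lone = block , e , l
Step-words {o} {p ∷ xs} {W} (move d crowd s) x with p ℤ.≟ x | Step-words s x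
... | no _ | r = r
... | yes refl | block , e , l rewrite crowd =
  block ++ d ∷ [] , trans e (sym (ListP.++-assoc block (d ∷ []) (W x))) ,
  trans (ListP.length-++ block) (trans (ℕP.+-comm (length block) 1) (cong suc l))

-- Conservation of particles: presences and departures against arrivals from both neighbours and the
-- initial `n` at the origin.
Balanced : ℕ → (ℤ → ℕ) → (ℤ → Word) → Set
Balanced n o W = ∀ x → o x ℕ.+ length (W x) ≡ #R (W (x ℤ.- + 1)) ℕ.+ #L (W (x ℤ.+ + 1)) ℕ.+ n ℕ.* indℤ (+ 0) x

-- `A` counts the particles already processed, at their new positions, so that conservation holds
-- after every single move within a step.
Step-balanced : ∀ {n o xs W ys W′} → Step o xs W ys W′ → (A : ℤ → ℕ) →
  Balanced n (λ x → occ xs x ℕ.+ A x) W → Balanced n (λ x → occ ys x ℕ.+ A x) W′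
Step-balanced [] A bal x = bal x
Step-balanced {n} (stay {p} {xs} {W} {ys} {W′} _ s) A bal x = trans
  (cong (ℕ._+ length (W′ x)) (regroup ys))
  (Step-balanced {n} s (λ x → indℤ p x ℕ.+ A x) (λ x → trans (cong (ℕ._+ length (W x)) (sym (regroup′ xs x))) (bal x)) x)
  where
    rearrange : ∀ a b c → a ℕ.+ b ℕ.+ c ≡ b ℕ.+ (a ℕ.+ c)
    rearrange = ℕR.solve-∀
    regroup′ : ∀ zs x → occ (p ∷ zs) x ℕ.+ A x ≡ occ zs x ℕ.+ (indℤ p x ℕ.+ A x)
    regroup′ zs x = trans (cong (ℕ._+ A x) (occ-∷ p zs x)) (rearrange (indℤ p x) (occ zs x) (A x))
    regroup = λ zs → regroup′ zs x
Step-balanced {n} (move {p} {xs} {W} {ys} {W′} d _ s) A bal x = trans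
  (cong (ℕ._+ length (W′ x)) (trans (cong (ℕ._+ A x) (occ-∷ (shift d p) ys x)) (rearrange (indℤ (shift d p) x) (occ ys x) (A x))))
  (Step-balanced {n} s (λ x → indℤ (shift d p) x ℕ.+ A x) bal′ x)
  where
    rearrange : ∀ a b c → a ℕ.+ b ℕ.+ c ≡ b ℕ.+ (a ℕ.+ c)
    rearrange = ℕR.solve-∀
    out : ∀ a b c d e → a ℕ.+ (b ℕ.+ c) ℕ.+ (d ℕ.+ e) ≡ b ℕ.+ (d ℕ.+ a ℕ.+ c ℕ.+ e)
    out = ℕR.solve-∀
    into : ∀ a b c d e → a ℕ.+ b ℕ.+ (c ℕ.+ d ℕ.+ e) ≡ a ℕ.+ c ℕ.+ (b ℕ.+ d) ℕ.+ e
    into = ℕR.solve-∀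
    bal′ : Balanced n (λ x → occ xs x ℕ.+ (indℤ (shift d p) x ℕ.+ A x)) (push W p d)
    bal′ x = begin
      occ xs x ℕ.+ (indℤ (shift d p) x ℕ.+ A x) ℕ.+ length (push W p d x)
        ≡⟨ cong (occ xs x ℕ.+ (indℤ (shift d p) x ℕ.+ A x) ℕ.+_) (length-push W p d x) ⟩
      occ xs x ℕ.+ (indℤ (shift d p) x ℕ.+ A x) ℕ.+ (indℤ p x ℕ.+ length (W x))
        ≡⟨ out (occ xs x) (indℤ (shift d p) x) (A x) (indℤ p x) (length (W x)) ⟩
      indℤ (shift d p) x ℕ.+ (indℤ p x ℕ.+ occ xs x ℕ.+ A x ℕ.+ length (W x))
        ≡⟨ cong₂ ℕ._+_ (sym (ind-shift d p x)) (trans (cong (λ k → k ℕ.+ A x ℕ.+ length (W x)) (sym (occ-∷ p xs x))) (bal x)) ⟩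
      indR d p (x ℤ.- + 1) ℕ.+ indL d p (x ℤ.+ + 1) ℕ.+ (#R (W (x ℤ.- + 1)) ℕ.+ #L (W (x ℤ.+ + 1)) ℕ.+ n ℕ.* indℤ (+ 0) x)
        ≡⟨ into (indR d p (x ℤ.- + 1)) _ _ _ _ ⟩
      indR d p (x ℤ.- + 1) ℕ.+ #R (W (x ℤ.- + 1)) ℕ.+ (indL d p (x ℤ.+ + 1) ℕ.+ #L (W (x ℤ.+ + 1))) ℕ.+ n ℕ.* indℤ (+ 0) x
        ≡⟨ cong (ℕ._+ n ℕ.* indℤ (+ 0) x) (sym (cong₂ ℕ._+_ (#R-push W p d (x ℤ.- + 1)) (#L-push W p d (x ℤ.+ + 1)))) ⟩
      #R (push W p d (x ℤ.- + 1)) ℕ.+ #L (push W p d (x ℤ.+ + 1)) ℕ.+ n ℕ.* indℤ (+ 0) x ∎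
      where open ≡-Reasoning

-- The invariant of the process.

record Invariant (n D : ℕ) (c : List ℤ) (W : ℤ → Word) : Set where
  field
    balanced : Balanced n (occ c) W
    -- A bound on words, not on positions: a particle that has just reached distance `suc D` does
    -- not violate it.
    unused : ∀ x → D ℕ.< ℤ.∣ x ∣ → W x ≡ []
    holes : ∀ x → occ c x ≡ 0 → occ c (x ℤ.+ + 1) ≡ 0 → 0 ℕ.< length (W x) → 0 ℕ.< length (W (x ℤ.+ + 1)) →
      endsLL (W x) ≡ true ⊎ endsRR (W (x ℤ.+ + 1)) ≡ true

occ-outside : ∀ {D} c x → All (λ y → ℤ.∣ y ∣ ℕ.≤ D) c → D ℕ.< ℤ.∣ x ∣ → occ c x ≡ 0
occ-outside [] x [] D<x = refl
occ-outside (y ∷ c) x (y≤D ∷ c≤D) D<x = trans (occ-∷ y c x)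
  (cong₂ ℕ._+_ (indℤ-≢ λ { refl → ℕP.<⇒≱ D<x y≤D }) (occ-outside c x c≤D D<x))

#R-++ : ∀ u w → #R (u ++ w) ≡ #R u ℕ.+ #R w
#R-++ [] w = refl
#R-++ (true ∷ u) w = cong suc (#R-++ u w)
#R-++ (false ∷ u) w = #R-++ u w

#L-++ : ∀ u w → #L (u ++ w) ≡ #L u ℕ.+ #L w
#L-++ [] w = refl
#L-++ (true ∷ u) w = #L-++ u w
#L-++ (false ∷ u) w = cong suc (#L-++ u w)

all-left : ∀ u w → #R u ≡ 0 → 2 ℕ.≤ length u → endsLL (u ++ w) ≡ true
all-left (false ∷ false ∷ u) w _ _ = refl
all-left (_ ∷ []) w _ (s≤s ())

all-right : ∀ u w → #L u ≡ 0 → 2 ℕ.≤ length u → endsRR (u ++ w) ≡ true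
all-right (true ∷ true ∷ u) w _ _ = refl
all-right (_ ∷ []) w _ (s≤s ())

module _ {n D c W c′ W′} (inv : Invariant n D c W) (s : Step c c W c′ W′) where
  open Invariant inv

  block : ℤ → Word
  block x = proj₁ (Step-words s x)

  W′≡ : ∀ x → W′ x ≡ block x ++ W x
  W′≡ x = proj₁ (proj₂ (Step-words s x))

  ∣block∣ : ∀ x → length (block x) ≡ departures c c x
  ∣block∣ x = proj₂ (proj₂ (Step-words s x))

  balanced′ : Balanced n (occ c′) W′
  balanced′ x = trans (cong (ℕ._+ length (W′ x)) (sym (ℕP.+-identityʳ (occ c′ x))))
    (Step-balanced {n} s (λ _ → 0) (λ x → trans (cong (ℕ._+ length (W x)) (ℕP.+-identityʳ (occ c x))) (balanced x)) x)

  arrivals : ∀ x → occ c′ x ℕ.+ departures c c x ≡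
    occ c x ℕ.+ (#R (block (x ℤ.- + 1)) ℕ.+ #L (block (x ℤ.+ + 1)))
  arrivals x = ℕP.+-cancelʳ-≡ (length (W x)) _ _ (begin
    occ c′ x ℕ.+ departures c c x ℕ.+ length (W x)
      ≡⟨ ℕP.+-assoc (occ c′ x) _ _ ⟩
    occ c′ x ℕ.+ (departures c c x ℕ.+ length (W x))
      ≡⟨ cong (occ c′ x ℕ.+_) (sym (trans (cong length (W′≡ x)) (trans (ListP.length-++ (block x)) (cong (ℕ._+ length (W x)) (∣block∣ x))))) ⟩
    occ c′ x ℕ.+ length (W′ x)
      ≡⟨ balanced′ x ⟩
    #R (W′ (x ℤ.- + 1)) ℕ.+ #L (W′ (x ℤ.+ + 1)) ℕ.+ n ℕ.* indℤ (+ 0) x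
      ≡⟨ cong (ℕ._+ n ℕ.* indℤ (+ 0) x) (cong₂ ℕ._+_
           (trans (cong #R (W′≡ (x ℤ.- + 1))) (#R-++ (block (x ℤ.- + 1)) _))
           (trans (cong #L (W′≡ (x ℤ.+ + 1))) (#L-++ (block (x ℤ.+ + 1)) _))) ⟩
    #R (block (x ℤ.- + 1)) ℕ.+ #R (W (x ℤ.- + 1)) ℕ.+ (#L (block (x ℤ.+ + 1)) ℕ.+ #L (W (x ℤ.+ + 1))) ℕ.+ n ℕ.* indℤ (+ 0) x
      ≡⟨ rearrange (#R (block (x ℤ.- + 1))) _ _ _ _ ⟩
    (#R (W (x ℤ.- + 1)) ℕ.+ #L (W (x ℤ.+ + 1)) ℕ.+ n ℕ.* indℤ (+ 0) x) ℕ.+ (#R (block (x ℤ.- + 1)) ℕ.+ #L (block (x ℤ.+ + 1)))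
      ≡⟨ cong (ℕ._+ (#R (block (x ℤ.- + 1)) ℕ.+ #L (block (x ℤ.+ + 1)))) (sym (balanced x)) ⟩
    occ c x ℕ.+ length (W x) ℕ.+ (#R (block (x ℤ.- + 1)) ℕ.+ #L (block (x ℤ.+ + 1)))
      ≡⟨ swap (occ c x) _ _ ⟩
    occ c x ℕ.+ (#R (block (x ℤ.- + 1)) ℕ.+ #L (block (x ℤ.+ + 1))) ℕ.+ length (W x) ∎)
    where
      open ≡-Reasoning
      rearrange : ∀ a b c d e → a ℕ.+ b ℕ.+ (c ℕ.+ d) ℕ.+ e ≡ (b ℕ.+ d ℕ.+ e) ℕ.+ (a ℕ.+ c)
      rearrange = ℕR.solve-∀
      swap : ∀ a b c → a ℕ.+ b ℕ.+ c ≡ a ℕ.+ c ℕ.+ b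
      swap = ℕR.solve-∀

  data Emptied (x : ℤ) : Set where
    was-empty : occ c x ≡ 0 → block x ≡ [] → Emptied x
    left : 2 ℕ.≤ length (block x) → Emptied x

  -- By `arrivals`: at a crowded site all particles leave, so those present afterwards are the
  -- newcomers; elsewhere nobody leaves, so former occupants and newcomers are both absent.
  emptied : ∀ x → occ c′ x ≡ 0 →
    #R (block (x ℤ.- + 1)) ≡ 0 × #L (block (x ℤ.+ + 1)) ≡ 0 × Emptied x
  emptied x e with crowded c x in crowd | arrivals x | ∣block∣ x
  ... | true | arr | len = ℕP.m+n≡0⇒m≡0 _ none , ℕP.m+n≡0⇒n≡0 (#R (block (x ℤ.- + 1))) none ,
      left (subst (2 ℕ.≤_) (sym len) (isYes⇒ (2 ℕ.≤? occ c x) crowd))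
    where
      none : #R (block (x ℤ.- + 1)) ℕ.+ #L (block (x ℤ.+ + 1)) ≡ 0
      none = ℕP.+-cancelˡ-≡ (occ c x) _ 0
        (trans (sym arr) (trans (cong (ℕ._+ occ c x) e) (sym (ℕP.+-identityʳ (occ c x)))))
  ... | false | arr | len = ℕP.m+n≡0⇒m≡0 _ none , ℕP.m+n≡0⇒n≡0 (#R (block (x ℤ.- + 1))) none ,
      was-empty (ℕP.m+n≡0⇒m≡0 _ zeros) (length≡0 (block x) len)
    where
      zeros : occ c x ℕ.+ (#R (block (x ℤ.- + 1)) ℕ.+ #L (block (x ℤ.+ + 1))) ≡ 0
      zeros = trans (sym arr) (cong (ℕ._+ 0) e)
      none : #R (block (x ℤ.- + 1)) ℕ.+ #L (block (x ℤ.+ + 1)) ≡ 0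
      none = ℕP.m+n≡0⇒n≡0 (occ c x) zeros
      length≡0 : ∀ (u : Word) → length u ≡ 0 → u ≡ []
      length≡0 [] _ = refl

  Step-invariant : All (λ y → ℤ.∣ y ∣ ℕ.≤ D) c → Invariant n D c′ W′
  Step-invariant c≤D = record { balanced = balanced′ ; unused = unused′ ; holes = holes′ }
    where
      unused′ : ∀ x → D ℕ.< ℤ.∣ x ∣ → W′ x ≡ []
      unused′ x D<x with block x | W′≡ x | ∣block∣ x
      ... | [] | e | _ = trans e (unused x D<x)
      ... | _ ∷ _ | _ | len rewrite occ-outside c x c≤D D<x with () ← len
      holes′ : ∀ x → occ c′ x ≡ 0 → occ c′ (x ℤ.+ + 1) ≡ 0 → 0 ℕ.< length (W′ x) → 0 ℕ.< length (W′ (x ℤ.+ + 1)) →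
        endsLL (W′ x) ≡ true ⊎ endsRR (W′ (x ℤ.+ + 1)) ≡ true
      -- A site vacated in this step sent nothing to its neighbour, which is empty afterwards; its
      -- block thus consists of at least two letters pointing away. If neither site was vacated now,
      -- both words are unchanged.
      holes′ x e e⁺ v v⁺ with emptied x e | emptied (x ℤ.+ + 1) e⁺
      ... | _ , L⁺≡0 , left 2≤ | R≡0 , _ , _ = inj₁ (trans (cong endsLL (W′≡ x))
          (all-left (block x) (W x) (subst (λ y → #R (block y) ≡ 0) (x+1-1 x) R≡0) 2≤))
      ... | _ , L⁺≡0 , was-empty _ _ | _ , _ , left 2≤ = inj₂ (trans (cong endsRR (W′≡ (x ℤ.+ + 1)))
          (all-right (block (x ℤ.+ + 1)) (W (x ℤ.+ + 1)) L⁺≡0 2≤))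
      ... | _ , _ , was-empty o≡0 b≡[] | _ , _ , was-empty o⁺≡0 b⁺≡[] =
          subst₂ (λ u u⁺ → endsLL u ≡ true ⊎ endsRR u⁺ ≡ true) (sym kept) (sym kept⁺)
            (holes x o≡0 o⁺≡0 (subst (λ u → 0 ℕ.< length u) kept v) (subst (λ u → 0 ℕ.< length u) kept⁺ v⁺))
        where
          kept : W′ x ≡ W x
          kept = trans (W′≡ x) (cong (_++ W x) b≡[])
          kept⁺ : W′ (x ℤ.+ + 1) ≡ W (x ℤ.+ + 1)
          kept⁺ = trans (W′≡ (x ℤ.+ + 1)) (cong (_++ W (x ℤ.+ + 1)) b⁺≡[])

Invariant-start : ∀ n D → Invariant n D (start n) (λ _ → [])
Invariant-start n D = record
  { balanced = λ x → trans (ℕP.+-identityʳ _) (occ-start n x) ; unused = λ _ _ → refl ; holes = λ _ _ _ () }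
  where
    occ-start : ∀ n x → occ (start n) x ≡ n ℕ.* indℤ (+ 0) x
    occ-start zero x = refl
    occ-start (suc n) x = trans (occ-∷ (+ 0) (start n) x) (cong (indℤ (+ 0) x ℕ.+_) (occ-start n x))

-- The two half-lines and their mirror symmetry.

rightward leftward : (ℤ → Word) → ℕ → Word
rightward W i = W (+ i)
-- `not` reverses directions, so that on both sides `true` points away from the origin.
leftward W i = map not (W (ℤ.- + i))

#R-mirror : ∀ w → #R (map not w) ≡ #L w
#R-mirror [] = refl
#R-mirror (true ∷ w) = #R-mirror w
#R-mirror (false ∷ w) = cong suc (#R-mirror w)

#L-mirror : ∀ w → #L (map not w) ≡ #R w
#L-mirror [] = refl
#L-mirror (true ∷ w) = cong suc (#L-mirror w)
#L-mirror (false ∷ w) = #L-mirror w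

endsLL-mirror : ∀ w → endsRR w ≡ true → endsLL (map not w) ≡ true
endsLL-mirror (true ∷ true ∷ w) _ = refl

endsRR-mirror : ∀ w → endsLL w ≡ true → endsRR (map not w) ≡ true
endsRR-mirror (false ∷ false ∷ w) _ = refl

module _ {n D c W} (inv : Invariant n D c W) where
  open Invariant inv

  rightHalf : HalfLine (λ i → occ c (+ i)) (rightward W)
  rightHalf = record { balance = bal ; holes = hol }
    where
      i+1 : ∀ i → + i ℤ.+ + 1 ≡ + suc i
      i+1 i = cong +_ (ℕP.+-comm i 1)
      bal : ∀ i → occ c (+ suc i) ℕ.+ length (W (+ suc i)) ≡ #R (W (+ i)) ℕ.+ #L (W (+ suc (suc i)))
      -- The initial particles do not enter, since site `suc i` is not the origin.
      bal i = trans (balanced (+ suc i)) (trans (cong (#R (W (+ i)) ℕ.+ #L (W (+ suc i ℤ.+ + 1)) ℕ.+_) (ℕP.*-zeroʳ n))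
        (trans (ℕP.+-identityʳ _) (cong (λ y → #R (W (+ i)) ℕ.+ #L (W y)) (i+1 (suc i)))))
      hol : ∀ i → occ c (+ i) ≡ 0 → occ c (+ suc i) ≡ 0 → 0 ℕ.< length (W (+ i)) → 0 ℕ.< length (W (+ suc i)) →
        endsLL (W (+ i)) ≡ true ⊎ endsRR (W (+ suc i)) ≡ true
      hol i rewrite sym (i+1 i) = holes (+ i)

  leftHalf : HalfLine (λ i → occ c (ℤ.- + i)) (leftward W)
  leftHalf = record { balance = bal ; holes = hol }
    where
      -i : ∀ i → ℤ.- + suc i ℤ.+ + 1 ≡ ℤ.- + i
      -i zero = refl
      -i (suc i) = refl
      -2-i : ∀ i → ℤ.- + suc i ℤ.- + 1 ≡ ℤ.- + suc (suc i)
      -2-i i = cong -[1+_] (cong suc (ℕP.+-identityʳ i))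
      bal : ∀ i → occ c (ℤ.- + suc i) ℕ.+ length (leftward W (suc i)) ≡ #R (leftward W i) ℕ.+ #L (leftward W (suc (suc i)))
      bal i = trans (cong (occ c (ℤ.- + suc i) ℕ.+_) (ListP.length-map not (W (ℤ.- + suc i))))
        (trans (balanced (ℤ.- + suc i)) (trans (cong (#R (W (ℤ.- + suc i ℤ.- + 1)) ℕ.+ #L (W (ℤ.- + suc i ℤ.+ + 1)) ℕ.+_) (ℕP.*-zeroʳ n)) (trans (ℕP.+-identityʳ _)
        (trans (ℕP.+-comm (#R (W (ℤ.- + suc i ℤ.- + 1))) _)
        (cong₂ ℕ._+_ (trans (cong (λ y → #L (W y)) (-i i)) (sym (#R-mirror (W (ℤ.- + i)))))
                     (trans (cong (λ y → #R (W y)) (-2-i i)) (sym (#L-mirror (W (ℤ.- + suc (suc i)))))))))))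
      nonempty : ∀ u → 0 ℕ.< length (map not u) → 0 ℕ.< length u
      nonempty u = subst (0 ℕ.<_) (ListP.length-map not u)
      hol : ∀ i → occ c (ℤ.- + i) ≡ 0 → occ c (ℤ.- + suc i) ≡ 0 →
        0 ℕ.< length (leftward W i) → 0 ℕ.< length (leftward W (suc i)) →
        endsLL (leftward W i) ≡ true ⊎ endsRR (leftward W (suc i)) ≡ true
      hol i e e′ v v′ with holes (ℤ.- + suc i) e′ (trans (cong (occ c) (-i i)) e) (nonempty (W (ℤ.- + suc i)) v′)
        (subst (λ y → 0 ℕ.< length (W y)) (sym (-i i)) (nonempty (W (ℤ.- + i)) v))
      ... | inj₁ LL = inj₂ (endsRR-mirror (W (ℤ.- + suc i)) LL)
      ... | inj₂ RR = inj₁ (endsLL-mirror (W (ℤ.- + i)) (subst (λ y → endsRR (W y) ≡ true) (-i i) RR))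

-- The effect of a single coin on the potential.

Branch-unchanged : ∀ v {V V′} → (∀ i → i ℕ.≤ v → V′ i ≡ V i) → Branch v V V′ V′
Branch-unchanged zero h = end
Branch-unchanged (suc v) h = same (h (suc v) ℕP.≤-refl) (h (suc v) ℕP.≤-refl)
  (Branch-unchanged v (λ i i≤v → h i (ℕP.m≤n⇒m≤1+n i≤v)))

BranchAt : (W W₀ W₁ : ℕ → Word) (Hit : ℕ → Set) → ℕ → Set
BranchAt W W₀ W₁ Hit i = (W₀ i ≡ W i × W₁ i ≡ W i) ⊎ (Hit i × W₀ i ≡ false ∷ W i × W₁ i ≡ true ∷ W i)

Branch-at : ∀ v {V V₀ V₁ : ℕ → Word} {Hit : ℕ → Set} → (∀ {i j} → Hit i → Hit j → i ≡ j) →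
  (∀ i → BranchAt V V₀ V₁ Hit i) → Branch v V V₀ V₁
Branch-at zero unique cases = end
Branch-at (suc v) {V} {V₀} {V₁} {Hit} unique cases with cases (suc v)
... | inj₁ (e₀ , e₁) = same e₀ e₁ (Branch-at v unique cases)
... | inj₂ (hit , e₀ , e₁) = here e₀ e₁
    (Branch-unchanged v (λ i i≤v → proj₁ (rest i i≤v))) (Branch-unchanged v (λ i i≤v → proj₂ (rest i i≤v)))
  where
    rest : ∀ i → i ℕ.≤ v → V₀ i ≡ V i × V₁ i ≡ V i
    rest i i≤v with cases i
    ... | inj₁ es = es
    ... | inj₂ (hit′ , _) = contradiction (unique hit′ hit) (ℕP.<⇒≢ (s≤s i≤v))

-+-injective : ∀ {i j} → ℤ.- + i ≡ ℤ.- + j → i ≡ j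
-+-injective e = ℤP.+-injective (ℤP.neg-injective e)

Branch-rightward : ∀ v W p → Branch v (rightward W) (rightward (push W p false)) (rightward (push W p true))
Branch-rightward v W p = Branch-at v {Hit = λ i → p ≡ + i} (λ e e′ → ℤP.+-injective (trans (sym e) e′)) cases
  where
    cases : ∀ i → BranchAt (rightward W) (rightward (push W p false)) (rightward (push W p true)) (λ i → p ≡ + i) i
    cases i with p ℤ.≟ + i
    ... | yes e = inj₂ (e , refl , refl)
    ... | no _ = inj₁ (refl , refl)

-- Reflection exchanges the two outcomes of the coin, hence the opposite order of `true` and
-- `false`.
Branch-leftward : ∀ v W p → Branch v (leftward W) (leftward (push W p true)) (leftward (push W p false))
Branch-leftward v W p = Branch-at v {Hit = λ i → p ≡ ℤ.- + i} (λ e e′ → -+-injective (trans (sym e) e′)) cases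
  where
    cases : ∀ i → BranchAt (leftward W) (leftward (push W p true)) (leftward (push W p false)) (λ i → p ≡ ℤ.- + i) i
    cases i with p ℤ.≟ ℤ.- + i
    ... | yes e = inj₂ (e , refl , refl)
    ... | no _ = inj₁ (refl , refl)

module _ (n D : ℕ) where

  -- `H` is a horizon: each particle processed takes one unit of it, so `t` remaining steps call for
  -- `t ℕ.* n`.
  potential : ℕ → (ℤ → Word) → ℚ
  potential H W = certsTotal n D H (rightward W) + certsTotal n D H (leftward W)

  potential-nonNeg : ∀ H W → 0ℚ ≤ potential H W
  potential-nonNeg H W = +-nonNeg (certsTotal-nonNeg n D H (rightward W)) (certsTotal-nonNeg n D H (leftward W))

  potential-suc : ∀ H W → potential H W ≤ potential (suc H) W
  potential-suc H W = +-mono-≤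
    (⊑⇒≤ (certsTotal-⊑ n H (Branch-unchanged D (λ _ _ → refl))))
    (⊑⇒≤ (certsTotal-⊑ n H (Branch-unchanged D (λ _ _ → refl))))

  potential-⊑ : ∀ H W p → potential H (push W p false) ⊕ potential H (push W p true) ⊑ potential (suc H) W
  potential-⊑ H W p = ⊑-+ (certsTotal-⊑ n H (Branch-rightward D W p)) (⊑-swap (certsTotal-⊑ n H (Branch-leftward D W p)))

-- The energy and its drift.

odd square : ℕ → ℚ
odd zero = 1ℚ
odd (suc m) = 2ℚ + odd m
-- As `odd m` is 2m + 1, this is m² as a sum of odd numbers.
square zero = 0ℚ
square (suc m) = square m + odd m

odd-nonNeg : ∀ m → 0ℚ ≤ odd m
odd-nonNeg zero = decided
odd-nonNeg (suc m) = +-nonNeg {2ℚ} decided (odd-nonNeg m)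

square-nonNeg : ∀ m → 0ℚ ≤ square m
square-nonNeg zero = ≤-refl
square-nonNeg (suc m) = +-nonNeg (square-nonNeg m) (odd-nonNeg m)

square-mono : ∀ {m k} → m ℕ.≤ k → square m ≤ square k
square-mono m≤k = go (ℕP.≤⇒≤′ m≤k)
  where
    go : ∀ {m k} → m ℕ.≤′ k → square m ≤ square k
    go ℕ.≤′-refl = ≤-refl
    go (ℕ.≤′-step {k} m≤k) = ≤-trans (go m≤k) (≤-+ʳ (square k) (odd-nonNeg k))

square-average : ∀ x → avg (square ℤ.∣ shift false x ∣) (square ℤ.∣ shift true x ∣) ≡ square ℤ.∣ x ∣ + 1ℚ
square-average (+ zero) = refl
square-average (+ suc m) = trans (cong (λ k → avg (square m) (square (suc k))) (ℕP.+-comm m 1))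
  (solve 2 (λ s o → con ½ :* s :+ con ½ :* (s :+ o :+ (con 2ℚ :+ o)) := s :+ o :+ con 1ℚ) refl (square m) (odd m))
square-average -[1+ m ] = trans (cong₂ (λ k j → avg (square (suc (suc k))) (square j)) (ℕP.+-identityʳ m) (toward m))
  (solve 2 (λ s o → con ½ :* (s :+ o :+ (con 2ℚ :+ o)) :+ con ½ :* s := s :+ o :+ con 1ℚ) refl (square m) (odd m))
  where
    toward : ∀ m → ℤ.∣ shift true -[1+ m ] ∣ ≡ m
    toward zero = refl
    toward (suc m) = refl

energy : List ℤ → ℚ
energy [] = 0ℚ
energy (x ∷ xs) = square ℤ.∣ x ∣ + energy xs

energy-nonNeg : ∀ xs → 0ℚ ≤ energy xs
energy-nonNeg [] = ≤-refl
energy-nonNeg (x ∷ xs) = +-nonNeg (square-nonNeg ℤ.∣ x ∣) (energy-nonNeg xs)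

capacity : ℕ → ℕ → ℚ
capacity B zero = 0ℚ
capacity B (suc m) = square B + capacity B m

energy-≤ : ∀ {B} xs → All (λ x → ℤ.∣ x ∣ ℕ.≤ B) xs → energy xs ≤ capacity B (length xs)
energy-≤ [] [] = ≤-refl
energy-≤ (x ∷ xs) (x≤B ∷ xs≤B) = +-mono-≤ (square-mono x≤B) (energy-≤ xs xs≤B)

movers : List ℤ → List ℤ → ℚ
movers o [] = 0ℚ
movers o (x ∷ xs) = indicator (crowded o x) + movers o xs

indicator-nonNeg : ∀ b → 0ℚ ≤ indicator b
indicator-nonNeg true = decided
indicator-nonNeg false = ≤-refl

movers-nonNeg : ∀ o xs → 0ℚ ≤ movers o xs
movers-nonNeg o [] = ≤-refl
movers-nonNeg o (x ∷ xs) = +-nonNeg (indicator-nonNeg (crowded o x)) (movers-nonNeg o xs)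

-- Together with `square-average`, this gives the energy a drift of at least 1 per step until the
-- process stops.
1≤movers : ∀ o xs → allB (λ x → ⌊ occ o x ℕ.≤? 1 ⌋) xs ≡ false → 1ℚ ≤ movers o xs
1≤movers o (x ∷ xs) e with occ o x ℕ.≤? 1
... | yes _ = ≤-trans (1≤movers o xs e) (≤-+ˡ (movers o xs) (indicator-nonNeg (crowded o x)))
... | no 1≱ with 2 ℕ.≤? occ o x
...   | yes _ = ≤-+ʳ 1ℚ (movers-nonNeg o xs)
...   | no 2≰ = contradiction (ℕP.≰⇒> 1≱) 2≰

-- Lower bounds for the expectation over one step.

stepAvg-nonNeg : ∀ o xs k → (∀ ys → 0ℚ ≤ k ys) → 0ℚ ≤ stepAvg o xs k
stepAvg-nonNeg o [] k h = h []
stepAvg-nonNeg o (x ∷ xs) k h with ⌊ 2 ℕ.≤? occ o x ⌋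
... | true = avg-nonNeg (stepAvg-nonNeg o xs _ (λ ys → h _)) (stepAvg-nonNeg o xs _ (λ ys → h _))
... | false = stepAvg-nonNeg o xs _ (λ ys → h _)

probStopWithin-nonNeg : ∀ D t c → 0ℚ ≤ probStopWithin D t c
probStopWithin-nonNeg D t c with done c
probStopWithin-nonNeg D t c | true = indicator-nonNeg (within D c)
probStopWithin-nonNeg D zero c | false = ≤-refl
probStopWithin-nonNeg D (suc t) c | false = stepAvg-nonNeg c c _ (probStopWithin-nonNeg D t)

-mono : ∀ {a b} → a ≤ b → - b ≤ - a
-mono = ℚP.neg-antimono-≤

module _ (o : List ℤ) {Ψ : ℕ → (ℤ → Word) → ℚ}
         (Ψ-suc : ∀ H W → Ψ H W ≤ Ψ (suc H) W)
         (Ψ-⊑ : ∀ H W p → Ψ H (push W p false) ⊕ Ψ H (push W p true) ⊑ Ψ (suc H) W)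
         {θ : ℚ} (0≤θ : 0ℚ ≤ θ) where

  -- Particle by particle: `Ψ` does not grow on average, a moving particle adds 1 to the expected
  -- energy, and `a` absorbs `θ` times the squares of the particles already processed. The horizon
  -- drops by one per particle, moving or not, so that it depends on `length xs` only.
  stepAvg-≥ : ∀ xs W H a k →
    (∀ {ys W′} → Step o xs W ys W′ → a - Ψ H W′ + θ * energy ys ≤ k ys) →
    a - Ψ (length xs ℕ.+ H) W + θ * (energy xs + movers o xs) ≤ stepAvg o xs k
  stepAvg-≥ [] W H a k h = ≤-trans
    (≤-reflexive (cong (λ e → a - Ψ H W + θ * e) (ℚP.+-identityʳ 0ℚ))) (h [])
  stepAvg-≥ (x ∷ xs) W H a k h with ⌊ 2 ℕ.≤? occ o x ⌋ in crowd
  ... | false = ≤-trans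
      (≤-trans (+-mono-≤ (+-mono-≤ (≤-refl {a}) (-mono (Ψ-suc (length xs ℕ.+ H) W))) ≤-refl)
        (≤-reflexive (solve 6 (λ a ψ θ q e m → a :- ψ :+ θ :* (q :+ e :+ (con 0ℚ :+ m)) := a :+ θ :* q :- ψ :+ θ :* (e :+ m))
          refl a (Ψ (length xs ℕ.+ H) W) θ (square ℤ.∣ x ∣) (energy xs) (movers o xs))))
      (stepAvg-≥ xs W H (a + θ * square ℤ.∣ x ∣) (λ ys → k (x ∷ ys)) λ {ys} {W′} s →
        ≤-trans (≤-reflexive (absorb x ys W′)) (h (stay crowd s)))
    where
      absorb : ∀ y ys W′ → a + θ * square ℤ.∣ y ∣ - Ψ H W′ + θ * energy ys ≡ a - Ψ H W′ + θ * energy (y ∷ ys)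
      absorb y ys W′ = solve 5 (λ a ψ θ q e → a :+ θ :* q :- ψ :+ θ :* e := a :- ψ :+ θ :* (q :+ e))
        refl a (Ψ H W′) θ (square ℤ.∣ y ∣) (energy ys)
  ... | true = ≤-trans
      (≤-trans (+-mono-≤ (+-mono-≤ (≤-refl {a}) (-mono (_⊕_⊑_.avg≤ (Ψ-⊑ (length xs ℕ.+ H) W x)))) ≤-refl)
        (≤-reflexive (trans
          (solve 7 (λ a ψ₀ ψ₁ θ q e m →
              a :- (con ½ :* ψ₀ :+ con ½ :* ψ₁) :+ θ :* (q :+ e :+ (con 1ℚ :+ m))
              := a :- (con ½ :* ψ₀ :+ con ½ :* ψ₁) :+ θ :* (e :+ m) :+ θ :* (q :+ con 1ℚ))
            refl a (ψ false) (ψ true) θ (square ℤ.∣ x ∣) (energy xs) (movers o xs))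
          (trans (cong (λ s → a - avg (ψ false) (ψ true) + θ * (energy xs + movers o xs) + θ * s) (sym (square-average x)))
          (solve 8 (λ a ψ₀ ψ₁ θ q₀ q₁ e m →
              a :- (con ½ :* ψ₀ :+ con ½ :* ψ₁) :+ θ :* (e :+ m) :+ θ :* (con ½ :* q₀ :+ con ½ :* q₁)
              := con ½ :* (a :+ θ :* q₀ :- ψ₀ :+ θ :* (e :+ m)) :+ con ½ :* (a :+ θ :* q₁ :- ψ₁ :+ θ :* (e :+ m)))
            refl a (ψ false) (ψ true) θ (q false) (q true) (energy xs) (movers o xs))))))
      (avg-mono (branch false) (branch true))
    where
      ψ q : Bool → ℚ
      ψ d = Ψ (length xs ℕ.+ H) (push W x d)
      q d = square ℤ.∣ shift d x ∣
      absorb : ∀ y ys W′ → a + θ * square ℤ.∣ y ∣ - Ψ H W′ + θ * energy ys ≡ a - Ψ H W′ + θ * energy (y ∷ ys)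
      absorb y ys W′ = solve 5 (λ a ψ θ q e → a :+ θ :* q :- ψ :+ θ :* e := a :- ψ :+ θ :* (q :+ e))
        refl a (Ψ H W′) θ (square ℤ.∣ y ∣) (energy ys)
      branch : ∀ d → a + θ * q d - ψ d + θ * (energy xs + movers o xs) ≤ stepAvg o xs (λ ys → k (shift d x ∷ ys))
      branch d = stepAvg-≥ xs (push W x d) H (a + θ * q d) (λ ys → k (shift d x ∷ ys)) λ {ys} {W′} s →
        ≤-trans (≤-reflexive (absorb (shift d x) ys W′)) (h (move d crowd s))

-- Exit from the range.

within⇒All : ∀ D c → within D c ≡ true → All (λ x → ℤ.∣ x ∣ ℕ.≤ D) c
within⇒All D [] e = []
within⇒All D (x ∷ c) e with ℤ.∣ x ∣ ℕ.≤? D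
... | yes x≤D = x≤D ∷ within⇒All D c e

outermost : ∀ D c → within D c ≡ false → All (λ x → ℤ.∣ x ∣ ℕ.≤ suc D) c →
  ∃ λ x → ℤ.∣ x ∣ ≡ suc D × 0 ℕ.< occ c x
outermost D (x ∷ c) e (x≤ ∷ c≤) with ℤ.∣ x ∣ ℕ.≤? D
... | no x≰D = x , ℕP.≤-antisym x≤ (ℕP.≰⇒> x≰D) ,
  subst (0 ℕ.<_) (sym (trans (occ-∷ x c x) (cong (ℕ._+ occ c x) (indℤ-refl x)))) (s≤s z≤n)
... | yes _ with outermost D c e c≤
...   | y , ∣y∣ , 0<occ = y , ∣y∣ , subst (0 ℕ.<_) (sym (occ-∷ x c y)) (ℕP.<-≤-trans 0<occ (ℕP.m≤n+m _ _))

total-cong : ∀ {f g} → (∀ i → f i ≡ g i) → ∀ m → total f m ≡ total g m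
total-cong h zero = refl
total-cong h (suc m) = cong₂ ℕ._+_ (h (suc m)) (total-cong h m)

total-+ : ∀ f g m → total (λ i → f i ℕ.+ g i) m ≡ total f m ℕ.+ total g m
total-+ f g zero = refl
total-+ f g (suc m) = trans (cong (f (suc m) ℕ.+ g (suc m) ℕ.+_) (total-+ f g m))
  (rearrange (f (suc m)) (g (suc m)) (total f m) (total g m))
  where
    rearrange : ∀ a b c d → a ℕ.+ b ℕ.+ (c ℕ.+ d) ≡ a ℕ.+ c ℕ.+ (b ℕ.+ d)
    rearrange = ℕR.solve-∀

total-0 : ∀ f m → (∀ i → i ℕ.≤ m → f i ≡ 0) → total f m ≡ 0
total-0 f zero h = refl
total-0 f (suc m) h = cong₂ ℕ._+_ (h (suc m) ℕP.≤-refl) (total-0 f m (λ i i≤m → h i (ℕP.m≤n⇒m≤1+n i≤m)))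

module _ {e : ℕ → ℤ} (e-injective : ∀ {i j} → e i ≡ e j → i ≡ j) where

  total-ind : ∀ y m → total (λ i → indℤ y (e i)) m ℕ.≤ 1
  total-ind y zero = z≤n
  total-ind y (suc m) with y ℤ.≟ e (suc m)
  ... | no _ = total-ind y m
  ... | yes refl = ℕP.≤-reflexive (cong suc (total-0 _ m λ i i≤m →
        indℤ-≢ λ eq → ℕP.<⇒≢ (s≤s i≤m) (sym (e-injective eq))))

  total-occ : ∀ c m → total (λ i → occ c (e i)) m ℕ.≤ length c
  total-occ [] m = ℕP.≤-reflexive (total-0 _ m (λ _ _ → refl))
  total-occ (y ∷ c) m = subst (ℕ._≤ suc (length c))
    (sym (trans (total-cong (λ i → occ-∷ y c (e i)) m) (total-+ (λ i → indℤ y (e i)) (λ i → occ c (e i)) m)))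
    (ℕP.+-mono-≤ (total-ind y m) (total-occ c m))

-- The particle at distance `suc D` starts a certificate on its own half-line; the other half-line
-- contributes a nonnegative amount.
1≤potential : ∀ {n D c W} H → Invariant n D c W → length c ≡ n → All (λ x → ℤ.∣ x ∣ ℕ.≤ suc D) c →
  within D c ≡ false → 1ℚ ≤ potential n D H W
1≤potential {n} {D} {c} {W} H inv len c≤ e with outermost D c e c≤
... | + _ , refl , 0<occ = ≤-trans
  (1≤certsTotal n (rightHalf inv) D H 0<occ
    (subst (total (λ i → occ c (+ i)) (suc D) ℕ.≤_) len (total-occ ℤP.+-injective c (suc D)))
    (Invariant.unused inv (+ suc D) ℕP.≤-refl) (Invariant.unused inv (+ suc (suc D)) (ℕP.n≤1+n _)))
  (≤-+ʳ _ (certsTotal-nonNeg n D H (leftward W)))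
... | -[1+ _ ] , refl , 0<occ = ≤-trans
  (1≤certsTotal n (leftHalf inv) D H 0<occ
    (subst (total (λ i → occ c (ℤ.- + i)) (suc D) ℕ.≤_) len (total-occ -+-injective c (suc D)))
    (cong (map not) (Invariant.unused inv -[1+ D ] ℕP.≤-refl))
    (cong (map not) (Invariant.unused inv -[1+ suc D ] (ℕP.n≤1+n _))))
  (≤-+ˡ _ (certsTotal-nonNeg n D H (rightward W)))

-- Induction over time for the probability of stopping.

fromℕ : ℕ → ℚ
fromℕ zero = 0ℚ
fromℕ (suc m) = 1ℚ + fromℕ m

module _ (n D : ℕ) {θ : ℚ} (0≤θ : 0ℚ ≤ θ) where

  private
    cap : ℚ
    cap = capacity (suc D) n

    Ψ : ℕ → (ℤ → Word) → ℚ
    Ψ = potential n D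

  lower-≤ : ∀ a {b} c W H → length c ≡ n → All (λ x → ℤ.∣ x ∣ ℕ.≤ suc D) c → a + θ * cap ≤ b →
    a - Ψ H W + θ * energy c ≤ b - Ψ H W
  lower-≤ a {b} c W H len c≤ h = ≤-trans
    (+-mono-≤ (≤-refl {a - Ψ H W}) (*-monoˡ 0≤θ (subst (λ m → energy c ≤ capacity (suc D) m) len (energy-≤ c c≤))))
    (≤-trans (≤-reflexive (solve 3 (λ a ψ e → a :- ψ :+ e := a :+ e :- ψ) refl a (Ψ H W) (θ * cap)))
      (+-mono-≤ h (≤-refl { - Ψ H W})))

  minus-≤ : ∀ b H W → b - Ψ H W ≤ b
  minus-≤ b H W = ≤-trans (+-mono-≤ (≤-refl {b}) (-mono (potential-nonNeg n D H W))) (≤-reflexive (ℚP.+-identityʳ b))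

  -- The constant `a` pays `θ` in each step, which the energy drift refunds. The two conditions on
  -- `a` make the bound at most 1 when the process stops in the range and at most 0 when time runs
  -- out. On exit it is at most 0 as well, the potential then being at least 1.
  probStopWithin-≥ : ∀ t a c W → length c ≡ n → within D c ≡ true → Invariant n D c W →
    a + θ * cap ≤ 1ℚ → a + θ * cap ≤ θ * fromℕ t →
    a - Ψ (t ℕ.* n) W + θ * energy c ≤ probStopWithin D t c
  probStopWithin-≥ t a c W len inside inv a≤1 a≤t with done c in fin
  probStopWithin-≥ t a c W len inside inv a≤1 a≤t | true rewrite inside =
    ≤-trans (lower-≤ a c W (t ℕ.* n) len (All.map ℕP.m≤n⇒m≤1+n (within⇒All D c inside)) a≤1) (minus-≤ 1ℚ (t ℕ.* n) W)
  probStopWithin-≥ zero a c W len inside inv a≤1 a≤t | false =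
    ≤-trans (lower-≤ a c W 0 len (All.map ℕP.m≤n⇒m≤1+n (within⇒All D c inside)) (≤-trans a≤t (≤-reflexive (ℚP.*-zeroʳ θ)))) (minus-≤ 0ℚ 0 W)
  probStopWithin-≥ (suc t) a c W len inside inv a≤1 a≤t | false = ≤-trans gain
    (stepAvg-≥ c {Ψ} (potential-suc n D) (potential-⊑ n D) 0≤θ c W (t ℕ.* n) (a - θ) (probStopWithin D t) outcome)
    where
      H = t ℕ.* n
      cH = length c ℕ.+ H
      c≤D = within⇒All D c inside
      gain : a - Ψ (n ℕ.+ H) W + θ * energy c ≤ a - θ - Ψ cH W + θ * (energy c + movers c c)
      gain = ≤-trans (≤-reflexive (trans (cong (λ l → a - Ψ (l ℕ.+ H) W + θ * energy c) (sym len))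
        (solve 4 (λ a ψ θ e → a :- ψ :+ θ :* e := a :- θ :- ψ :+ θ :* (e :+ con 1ℚ)) refl a (Ψ cH W) θ (energy c))))
        (+-mono-≤ (≤-refl {a - θ - Ψ cH W}) (*-monoˡ 0≤θ (+-mono-≤ (≤-refl {energy c}) (1≤movers c c fin))))
      pass : ∀ b → a + θ * cap ≤ b → a - θ + θ * cap ≤ b - θ
      pass b h = ≤-trans (≤-reflexive (solve 3 (λ a θ e → a :- θ :+ e := a :+ e :- θ) refl a θ (θ * cap)))
        (+-mono-≤ h (≤-refl { - θ}))
      a′≤1 : a - θ + θ * cap ≤ 1ℚ
      a′≤1 = ≤-trans (pass 1ℚ a≤1) (≤-trans (+-mono-≤ (≤-refl {1ℚ}) (-mono 0≤θ)) (≤-reflexive (ℚP.+-identityʳ 1ℚ)))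
      a′≤t : a - θ + θ * cap ≤ θ * fromℕ t
      a′≤t = ≤-trans (pass (θ * fromℕ (suc t)) a≤t)
        (≤-reflexive (solve 2 (λ θ t → θ :* (con 1ℚ :+ t) :- θ := θ :* t) refl θ (fromℕ t)))
      outcome : ∀ {c′ W′} → Step c c W c′ W′ → a - θ - Ψ H W′ + θ * energy c′ ≤ probStopWithin D t c′
      outcome {c′} {W′} s with within D c′ in e
      ... | true = probStopWithin-≥ t (a - θ) c′ W′ (trans (Step-length s) len) e (Step-invariant inv s c≤D) a′≤1 a′≤t
      ... | false = ≤-trans (lower-≤ (a - θ) c′ W′ H len′ c′≤ a′≤1) (≤-trans
          (+-mono-≤ (≤-refl {1ℚ}) (-mono (1≤potential H (Step-invariant inv s c≤D) len′ c′≤ e)))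
          (≤-trans (≤-reflexive (ℚP.+-inverseʳ 1ℚ)) (probStopWithin-nonNeg D t c′)))
        where
          len′ = trans (Step-length s) len
          c′≤ = Step-range s c≤D

-- Archimedean estimates.

fromℕ-nonNeg : ∀ m → 0ℚ ≤ fromℕ m
fromℕ-nonNeg zero = ≤-refl
fromℕ-nonNeg (suc m) = +-nonNeg {1ℚ} decided (fromℕ-nonNeg m)

fromℕ-+ : ∀ m k → fromℕ (m ℕ.+ k) ≡ fromℕ m + fromℕ k
fromℕ-+ zero k = sym (ℚP.+-identityˡ (fromℕ k))
fromℕ-+ (suc m) k = trans (cong (λ x → 1ℚ + x) (fromℕ-+ m k)) (sym (ℚP.+-assoc 1ℚ (fromℕ m) (fromℕ k)))

toℚᵘ-fromℕ : ∀ m → toℚᵘ (fromℕ m) ℚᵘ.≃ mkℚᵘ (+ m) 0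
toℚᵘ-fromℕ zero = ℚᵘP.≃-refl
toℚᵘ-fromℕ (suc m) = ℚᵘP.≃-trans (ℚP.toℚᵘ-homo-+ 1ℚ (fromℕ m)) (ℚᵘP.≃-trans
  (ℚᵘP.+-congʳ ℚᵘ.1ℚᵘ (toℚᵘ-fromℕ m)) (*≡* (num (+ m))))
  where
    num : ∀ i → (+ 1 ℤ.* + 1 ℤ.+ i ℤ.* + 1) ℤ.* + 1 ≡ (+ 1 ℤ.+ i) ℤ.* + 1
    num = ℤR.solve-∀

archimedean : ∀ p → ∃ λ m → p ≤ fromℕ m
archimedean p@(mkℚ i d _) = ℤ.∣ i ∣ , ℚP.toℚᵘ-cancel-≤ (ℚᵘP.≤-respʳ-≃ (ℚᵘP.≃-sym (toℚᵘ-fromℕ ℤ.∣ i ∣)) (*≤* le))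
  where
    le : i ℤ.* + 1 ℤ.≤ + ℤ.∣ i ∣ ℤ.* + suc d
    le = ℤP.≤-trans (ℤP.≤-reflexive (ℤP.*-identityʳ i)) (ℤP.≤-trans (i≤∣i∣ i)
      (ℤP.≤-trans (ℤ.+≤+ (ℕP.m≤m*n ℤ.∣ i ∣ (suc d))) (ℤP.≤-reflexive (ℤP.pos-* ℤ.∣ i ∣ (suc d)))))
      where
        i≤∣i∣ : ∀ i → i ℤ.≤ + ℤ.∣ i ∣
        i≤∣i∣ (+ m) = ℤP.≤-refl
        i≤∣i∣ -[1+ m ] = ℤ.-≤+

½^m*m≤1 : ∀ m → ½ ^ m * fromℕ m ≤ 1ℚ
½^m*m≤1 zero = decided
½^m*m≤1 (suc m) = ≤-trans (≤-reflexive
  (solve 2 (λ h x → con ½ :* h :* (con 1ℚ :+ x) := con ½ :* h :+ con ½ :* (h :* x)) refl (½ ^ m) (fromℕ m)))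
  (≤-trans (avg-mono (½^≤1 m) (½^m*m≤1 m)) (≤-reflexive (avg-idem 1ℚ)))
  where
    ½^≤1 : ∀ m → ½ ^ m ≤ 1ℚ
    ½^≤1 zero = ≤-refl
    ½^≤1 (suc m) = ≤-trans (½-mono (½^≤1 m)) (decided {½ * 1ℚ})

½^-small : ∀ {ε} M → 0ℚ < ε → ∃ λ j → ½ ^ j * M ≤ ε
½^-small {ε} M 0<ε = j , ≤-trans (≤-reflexive split) (≤-trans
    (*-monoˡ (ℚP.<⇒≤ 0<ε) (≤-trans (*-monoˡ (^-nonNeg j 0≤½) (proj₂ arch)) (½^m*m≤1 j)))
    (≤-reflexive (ℚP.*-identityʳ ε)))
  where
    instance _ = >-nonZero 0<ε
    arch = archimedean (M * 1/ ε)
    -- `j` bounds M / ε, whence ½ʲ M = ε ½ʲ (M / ε) ≤ ε ½ʲ j ≤ ε.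
    j = proj₁ arch
    split : ½ ^ j * M ≡ ε * (½ ^ j * (M * 1/ ε))
    split = sym (trans (solve 4 (λ ε h M i → ε :* (h :* (M :* i)) := h :* M :* (ε :* i)) refl ε (½ ^ j) M (1/ ε))
      (trans (cong (½ ^ j * M *_) (ℚP.*-inverseʳ ε)) (ℚP.*-identityʳ (½ ^ j * M))))

½^-anti : ∀ {m k} → m ℕ.≤ k → ½ ^ k ≤ ½ ^ m
½^-anti m≤k = go (ℕP.≤⇒≤′ m≤k)
  where
    go : ∀ {m k} → m ℕ.≤′ k → ½ ^ k ≤ ½ ^ m
    go ℕ.≤′-refl = ≤-refl
    go (ℕ.≤′-step {k} m≤k) = ≤-trans (≤-trans (≤-+ʳ (½ ^ suc k) (*-nonNeg 0≤½ (^-nonNeg k 0≤½)))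
      (≤-reflexive (avg-idem (½ ^ k)))) (go m≤k)

½^*2^ : ∀ j → ½ ^ j * fromℕ (2 ℕ.^ j) ≡ 1ℚ
½^*2^ zero = refl
½^*2^ (suc j) = trans (cong (½ ^ suc j *_) (trans (cong (λ k → fromℕ (2 ℕ.^ j ℕ.+ k)) (ℕP.+-identityʳ (2 ℕ.^ j))) (fromℕ-+ (2 ℕ.^ j) (2 ℕ.^ j))))
  (trans (solve 2 (λ h x → con ½ :* h :* (x :+ x) := h :* x) refl (½ ^ j) (fromℕ (2 ℕ.^ j))) (½^*2^ j))

^-+ : ∀ x a b → x ^ (a ℕ.+ b) ≡ x ^ a * x ^ b
^-+ x zero b = sym (ℚP.*-identityˡ (x ^ b))
^-+ x (suc a) b = trans (cong (x *_) (^-+ x a b)) (sym (ℚP.*-assoc x (x ^ a) (x ^ b)))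

-- Choice of constants and conclusion.

-- 18 is the least K with 73 (3/4)ᴷ ≤ 1/2.
weight-decay : ∀ n → weight (18 ℕ.* n) n ≤ ½ ^ n
weight-decay n = subst (λ m → weight m n ≤ ½ ^ n) (ℕP.*-comm n 18) (go n)
  where
    go : ∀ n → weight (n ℕ.* 18) n ≤ ½ ^ n
    go zero = decided
    go (suc n) = ≤-trans (≤-reflexive (trans (cong (_* Z ^ suc n) (^-+ ¾ 18 (n ℕ.* 18)))
      (solve 4 (λ k p z c → k :* p :* (c :* z) := p :* z :* (k :* c)) refl (¾ ^ 18) (¾ ^ (n ℕ.* 18)) (Z ^ n) Z)))
      (≤-trans (*-monoˡ (weight-nonNeg (n ℕ.* 18) n) (decided {¾ ^ 18 * Z} {½}))
      (≤-trans (≤-reflexive (ℚP.*-comm (weight (n ℕ.* 18) n) ½)) (½-mono (go n))))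

within-start : ∀ D n → within D (start n) ≡ true
within-start D zero = refl
within-start D (suc n) = within-start D n

potential-start : ∀ n H → potential n (18 ℕ.* n) H (λ _ → []) ≤ ½ ^ n
potential-start n H = ≤-trans (+-mono-≤ (certsTotal-initial n (18 ℕ.* n) H) (certsTotal-initial n (18 ℕ.* n) H))
  (≤-trans (≤-reflexive (solve 1 (λ x → con ⅛ :* x :+ con ⅛ :* x := x :* con (+ 1 / 4)) refl X))
  (≤-trans (*-monoˡ (weight-nonNeg (18 ℕ.* n) n) (decided {+ 1 / 4} {1ℚ}))
  (≤-trans (≤-reflexive (ℚP.*-identityʳ X)) (weight-decay n))))
  where X = weight (18 ℕ.* n) n

theorem1 : Σ ℕ λ K → (ε : ℚ) → 0ℚ < ε → Σ ℕ λ N → (n : ℕ) → N ℕ.≤ n →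
    Σ ℕ λ t → 1ℚ - ε ≤ probStopWithin (K ℕ.* n) t (start n)
theorem1 = 18 , λ ε 0<ε →
  -- One half of `ε` covers exit from the range, through the initial potential of at most ½ⁿ; the
  -- other covers running out of time.
  let 0<½ε : 0ℚ < ½ * ε
      0<½ε = ℚP.<-respˡ-≡ (ℚP.*-zeroʳ ½) (ℚP.*-monoʳ-<-pos ½ 0<ε)
      N , ½^N≤ = ½^-small 1ℚ 0<½ε
  in N , λ n N≤n →
  let D = 18 ℕ.* n
      cap = capacity (suc D) n
      -- A small `θ` makes the energy capacity cost at most ε / 2. With `t = 2 ℕ.^ j` the product of
      -- `θ` and `t` is 1, so `1ℚ - θ * cap` meets both conditions on `a` with equality.
      j , θcap≤ = ½^-small cap 0<½ε
      θ = ½ ^ j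
      t = 2 ℕ.^ j
      0≤θ = ^-nonNeg j 0≤½
      a+ : 1ℚ - θ * cap + θ * cap ≡ 1ℚ
      a+ = solve 1 (λ x → con 1ℚ :- x :+ x := con 1ℚ) refl (θ * cap)
      ½^n≤ : ½ ^ n ≤ ½ * ε
      ½^n≤ = ≤-trans (½^-anti N≤n) (≤-trans (≤-reflexive (sym (ℚP.*-identityʳ (½ ^ N)))) ½^N≤)
  in t , ≤-trans
    (≤-trans (≤-reflexive (solve 1 (λ ε → con 1ℚ :- ε := con 1ℚ :- con ½ :* ε :- con ½ :* ε) refl ε))
    (≤-trans (+-mono-≤ (+-mono-≤ (≤-refl {1ℚ}) (-mono θcap≤)) (-mono (≤-trans (potential-start n (t ℕ.* n)) ½^n≤)))
      (≤-+ʳ _ (*-nonNeg 0≤θ (energy-nonNeg (start n))))))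
    (probStopWithin-≥ n D 0≤θ t (1ℚ - θ * cap) (start n) (λ _ → []) (ListP.length-replicate n) (within-start D n)
      (Invariant-start n D) (≤-reflexive a+) (≤-reflexive (trans a+ (sym (½^*2^ j)))))
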